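{- Let $n\ge 1$ be an integer, let $(G,S_1,S_2)$ be an $(n\times n)$-slab whose rows and columns have maximum degree at most $\Delta$, where $\Delta\ge 3$, and let $X$ be a subset of $V(G)\setminus (V(S_1)\cup V(S_2))$. If every path in $G$ from $S_1$ to $S_2$ intersects $X$, then $G[X]$ has tree-width at least $\frac{n}{\sqrt{3\Delta}}-1$.
   Context: Graphs are finite and simple. A plane graph $H$ is a near-triangulation if every face of $H$ except for the outer one has length three. A triple $(G,S_1,S_2)$, where $G$ is a graph and $S_1$ and $S_2$ are vertex-disjoint connected subgraphs of $G$, is an $(n\times n)$-slab (with sides $S_1$ and $S_2$) if there exist pairwise vertex-disjoint near-triangulations $R_1,\ldots,R_n\subseteq G$ (the rows of the slab; each is a subgraph of $G$ equipped with a plane embedding) and pairwise vertex-disjoint near-triangulations $C_1,\ldots,C_n\subseteq G$ (the columns of the slab) such that: (1) for $1\le i,j\le n$, the intersection $R_i\cap C_j$ is a path with one end in $S_1$ and the other end in $S_2$; and (2) for $s\in\{1,2\}$ and for every row or column $H$, the intersection of $H$ with $S_s$ is a subpath of the boundary of the outer face of $H$. The hypothesis on $\Delta$ means that the rows and columns can be chosen so that each of the graphs $R_1,\ldots,R_n,C_1,\ldots,C_n$ has maximum degree at most $\Delta$. Tree-width is the minimum width of a tree decomposition, where width is the maximum bag size minus one. -}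

module Defs where

open import Data.Bool.Base using (if_then_else_)
open import Data.Empty using (⊥-elim)
open import Data.Fin.Base using (Fin; zero; suc; inject₁; fromℕ)
import Data.Fin.Properties as Fin
open import Data.Fin.Subset
  using (Subset; ⊥; ⊤; _∈_; _⊆_; _∩_; ∣_∣; Nonempty; Empty)
open import Data.Fin.Subset.Properties
  using (_∈?_; ∉⊥; ∈⊤; x∈p∩q⁺; x∈p∩q⁻; p∩q⊆p)
open import Data.Integer.Base as ℤ using (ℤ; +_; _⊖_; 0ℤ; 1ℤ)
import Data.Integer.Properties as ℤ
open import Data.List.Base
  using (List; length; filter; allFin; cartesianProduct; tabulate)
open import Data.List.Extrema.Nat using (max)
open import Data.Nat.Base using (ℕ; suc; _+_; _*_; _≤_; _<_)
open import Data.Nat.GeneralisedArithmetic using (iterate)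
open import Data.Nat.Induction using (<-rec)
import Data.Nat.Properties as ℕ
open import Data.Product.Base using (Σ; ∃; ∃₂; ∃-syntax; _×_; _,_; proj₁; proj₂)
open import Data.Sum.Base using (_⊎_)
open import Function.Bundles using (_⇔_)
open import Function.Definitions using (Injective)
open import Relation.Binary.Construct.Closure.ReflexiveTransitive using (Star; ε)
open import Relation.Binary.PropositionalEquality
  using (_≡_; _≢_; refl)
open import Relation.Nullary using (¬_; yes; no; does)

------------------------------------------------------------------------
-- Finite simple graphs

-- The vertex set is a subset of Fin N, so that a graph and all of its
-- subgraphs inhabit the same type.

record Graph (N : ℕ) : Set where
  field
    V           : Subset N
    nbrs        : Fin N → Subset N
    nbrs⊆V      : ∀ {u} → nbrs u ⊆ V
    symmetric   : ∀ {u v} → v ∈ nbrs u → u ∈ nbrs v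
    irreflexive : ∀ {u} → ¬ (u ∈ nbrs u)

open Graph public

infix 4 _⊢_~_ _⊑_

_⊢_~_ : ∀ {N} → Graph N → Fin N → Fin N → Set
H ⊢ u ~ v = v ∈ nbrs H u

_⊑_ : ∀ {N} → Graph N → Graph N → Set
H ⊑ G = V H ⊆ V G × (∀ {u} → nbrs H u ⊆ nbrs G u)

VertexDisjoint : ∀ {N} → Graph N → Graph N → Set
VertexDisjoint H K = Empty (V H ∩ V K)

infixr 7 _⊓_

_⊓_ : ∀ {N} → Graph N → Graph N → Graph N
V           (H ⊓ K)   = V H ∩ V K
nbrs        (H ⊓ K) u = nbrs H u ∩ nbrs K u
nbrs⊆V      (H ⊓ K) p = let q , r = x∈p∩q⁻ _ _ p
                        in x∈p∩q⁺ (nbrs⊆V H q , nbrs⊆V K r)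
symmetric   (H ⊓ K) p = let q , r = x∈p∩q⁻ _ _ p
                        in x∈p∩q⁺ (symmetric H q , symmetric K r)
irreflexive (H ⊓ K) p = irreflexive H (p∩q⊆p _ _ p)

induced : ∀ {N} → Graph N → Subset N → Graph N
induced {N} G X = record
  { V           = V G ∩ X
  ; nbrs        = nb
  ; nbrs⊆V      = λ p → let _ , q , r = from p in x∈p∩q⁺ (nbrs⊆V G q , r)
  ; symmetric   = λ p → let s , q , r = from p in to r (symmetric G q) s
  ; irreflexive = λ p → irreflexive G (proj₁ (proj₂ (from p)))
  }
  where
  nb : Fin N → Subset N
  nb u = if does (u ∈? X) then nbrs G u ∩ X else ⊥

  from : ∀ {u v} → v ∈ nb u → u ∈ X × G ⊢ u ~ v × v ∈ X
  from {u} p with u ∈? X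
  ... | yes s = s , x∈p∩q⁻ _ _ p
  ... | no  _ = ⊥-elim (∉⊥ p)

  to : ∀ {u v} → u ∈ X → G ⊢ u ~ v → v ∈ X → v ∈ nb u
  to {u} s q r with u ∈? X
  ... | yes _ = x∈p∩q⁺ (q , r)
  ... | no ¬s = ⊥-elim (¬s s)

MaxDegree≤ : ∀ {N} → ℕ → Graph N → Set
MaxDegree≤ Δ H = ∀ {v} → v ∈ V H → ∣ nbrs H v ∣ ≤ Δ

Linked : ∀ {N} → Graph N → Fin N → Fin N → Set
Linked H = Star (H ⊢_~_)

Connected : ∀ {N} → Graph N → Set
Connected H = ∀ {u v} → u ∈ V H → v ∈ V H → Linked H u v

record IsPath {N} (P : Graph N) (a b : Fin N) : Set where
  field
    len       : ℕ
    seq       : Fin (suc len) → Fin N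
    injective : Injective _≡_ _≡_ seq
    start     : seq zero ≡ a
    end       : seq (fromℕ len) ≡ b
    vertices  : ∀ v → v ∈ V P ⇔ (∃[ i ] seq i ≡ v)
    edges     : ∀ u v → P ⊢ u ~ v ⇔
                  (∃[ i ] ((seq (inject₁ i) ≡ u × seq (suc i) ≡ v) ⊎
                           (seq (inject₁ i) ≡ v × seq (suc i) ≡ u)))

record Cycle {N} (H : Graph N) : Set where
  field
    k         : ℕ
    seq       : Fin (3 + k) → Fin N
    injective : Injective _≡_ _≡_ seq
    step      : ∀ i → H ⊢ seq (inject₁ i) ~ seq (suc i)
    close     : H ⊢ seq (fromℕ _) ~ seq zero

-- H has exactly c components; root picks one vertex in each of them.

record HasComponents {N} (H : Graph N) (c : ℕ) : Set where
  field
    root     : Fin c → Fin N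
    root∈V   : ∀ i → root i ∈ V H
    reached  : ∀ {v} → v ∈ V H → ∃[ i ] Linked H (root i) v
    distinct : ∀ {i j} → Linked H (root i) (root j) → i ≡ j

-- A dart is an edge with a direction.

darts : ∀ {N} → Graph N → List (Fin N × Fin N)
darts {N} H =
  filter (λ (u , v) → v ∈? nbrs H u) (cartesianProduct (allFin N) (allFin N))

#edges : ∀ {N} → Graph N → ℕ
#edges H = length (filter (λ (u , v) → u Fin.<? v) (darts H))

------------------------------------------------------------------------
-- Plane graphs

-- A plane embedding is given combinatorially, by the clockwise cyclic order of
-- the neighbours of each vertex and by the face to the left of each dart.
-- H may be disconnected, in which case the rotations do not determine how the
-- components are nested; hence faces are part of the data, several facial walks
-- may belong to one face, and isolated vertices are assigned to faces as well.
--
-- Why euler and joined express planarity: let o be the number of facial walks,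
-- isolated vertices included, and g the sum of the genera of the components,
-- so that |V| - |E| + o = 2c - 2g.  By joined, the bipartite incidence graph
-- of the c components and the f faces, which has an edge for each facial
-- walk, is connected, so o ≥ c + f - 1.  Therefore |V| - |E| + f ≤ 1 + c - 2g,
-- and equality with 1 + c holds exactly when g = 0 and that incidence graph is
-- a tree, i.e. when the data describe a drawing in the sphere.  The choice of
-- an outer face then turns it into a drawing in the plane.

record PlaneEmbedding {N} (H : Graph N) : Set where
  field
    -- rot u restricts to a cyclic permutation of the neighbours of u.
    rot        : Fin N → Fin N → Fin N
    rot-closed : ∀ {u v} → H ⊢ u ~ v → H ⊢ u ~ rot u v
    rot-cyclic : ∀ {u v w} → H ⊢ u ~ v → H ⊢ u ~ w →
                 ∃[ k ] iterate (rot u) v k ≡ w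

    -- left u v is meaningful only if u ~ v, and around v only if v is an
    -- isolated vertex.  The dart following u → v on the boundary of the
    -- face to its left is v → rot v u.
    #faces    : ℕ
    left      : Fin N → Fin N → Fin #faces
    left-next : ∀ {u v} → H ⊢ u ~ v → left u v ≡ left v (rot v u)
    around    : Fin N → Fin #faces

  Incident : Fin #faces → Fin N → Set
  Incident f v = (∃[ w ] (H ⊢ v ~ w × left v w ≡ f))
               ⊎ (v ∈ V H × Empty (nbrs H v) × around v ≡ f)

  field
    joined : ∀ f g → Star (λ f g → ∃[ v ] (Incident f v × Incident g v)) f g

    #components : ℕ
    components  : HasComponents H #components
    euler       : ∣ V H ∣ + #faces ≡ #edges H + (1 + #components)

  -- An edge with the same face on both sides counts twice.
  faceLength : Fin #faces → ℕ
  faceLength f = length (filter (λ (u , v) → left u v Fin.≟ f) (darts H))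

  -- P, a subgraph of H, is contained in the boundary of the face f.
  OnBoundary : Fin #faces → Graph N → Set
  OnBoundary f P = (∀ {v} → v ∈ V P → Incident f v)
                 × (∀ {u v} → P ⊢ u ~ v → left u v ≡ f ⊎ left v u ≡ f)

record NearTriangulation {N} (H : Graph N) : Set where
  field
    embedding : PlaneEmbedding H
  open PlaneEmbedding embedding public
  field
    outer : Fin #faces
    inner : ∀ {f} → f ≢ outer → faceLength f ≡ 3

------------------------------------------------------------------------
-- Slabs

MeetsInOuterPath : ∀ {N} {H : Graph N} → NearTriangulation H → Graph N → Set
MeetsInOuterPath {H = H} T S =
  (∃₂ λ a b → IsPath (H ⊓ S) a b) × OnBoundary outer (H ⊓ S)
  where open NearTriangulation T

record Slab {N} (n : ℕ) (G S₁ S₂ : Graph N) : Set where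
  field
    S₁⊑G         : S₁ ⊑ G
    S₂⊑G         : S₂ ⊑ G
    S₁-connected : Connected S₁
    S₂-connected : Connected S₂
    S₁-S₂        : VertexDisjoint S₁ S₂

    row col      : Fin n → Graph N
    row⊑G        : ∀ i → row i ⊑ G
    col⊑G        : ∀ j → col j ⊑ G
    row-nearTri  : ∀ i → NearTriangulation (row i)
    col-nearTri  : ∀ j → NearTriangulation (col j)
    row-disjoint : ∀ {i j} → i ≢ j → VertexDisjoint (row i) (row j)
    col-disjoint : ∀ {i j} → i ≢ j → VertexDisjoint (col i) (col j)

    crossing : ∀ i j →
      ∃₂ λ a b → IsPath (row i ⊓ col j) a b × a ∈ V S₁ × b ∈ V S₂

    row-S₁ : ∀ i → MeetsInOuterPath (row-nearTri i) S₁
    row-S₂ : ∀ i → MeetsInOuterPath (row-nearTri i) S₂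
    col-S₁ : ∀ j → MeetsInOuterPath (col-nearTri j) S₁
    col-S₂ : ∀ j → MeetsInOuterPath (col-nearTri j) S₂

SlabDegree≤ : ∀ {N n} {G S₁ S₂ : Graph N} → ℕ → Slab n G S₁ S₂ → Set
SlabDegree≤ Δ slab =
  (∀ i → MaxDegree≤ Δ (row i)) × (∀ j → MaxDegree≤ Δ (col j))
  where open Slab slab

Separates : ∀ {N} → Graph N → Graph N → Graph N → Subset N → Set
Separates G S₁ S₂ X = ∀ P {a b} → P ⊑ G → IsPath P a b →
  a ∈ V S₁ → b ∈ V S₂ → Nonempty (V P ∩ X)

------------------------------------------------------------------------
-- Tree-width

record IsTree {M} (T : Graph M) : Set where
  field
    nonempty  : Nonempty (V T)
    connected : Connected T
    acyclic   : ¬ Cycle T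

record TreeDecomposition {N} (H : Graph N) : Set where
  field
    {M}           : ℕ
    tree          : Graph M
    isTree        : IsTree tree
    spanning      : V tree ≡ ⊤
    bag           : Fin M → Subset N
    bag⊆V         : ∀ t → bag t ⊆ V H
    vertexCovered : ∀ {v} → v ∈ V H → ∃[ t ] v ∈ bag t
    edgeCovered   : ∀ {u v} → H ⊢ u ~ v → ∃[ t ] (u ∈ bag t × v ∈ bag t)
    coherent      : ∀ {v s t} → v ∈ bag s → v ∈ bag t →
      Star (λ x y → tree ⊢ x ~ y × v ∈ bag x × v ∈ bag y) s t

  maxBag : ℕ
  maxBag = max 0 (tabulate (λ t → ∣ bag t ∣))

  -- The graph without vertices has a decomposition of width -1.
  width : ℤ
  width = maxBag ⊖ 1

open TreeDecomposition public using (maxBag; width)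

IsTreeWidth : ∀ {N} → Graph N → ℤ → Set
IsTreeWidth H w = (Σ (TreeDecomposition H) λ D → width D ≡ w)
                × (∀ (D : TreeDecomposition H) → w ℤ.≤ width D)

-- Constructively, the tree-width is a relation rather than a function; it
-- is not vacuous.

trivialDecomposition : ∀ {N} (H : Graph N) → TreeDecomposition H
trivialDecomposition H = record
  { M             = 1
  ; tree          = K₁
  ; isTree        = record
    { nonempty  = zero , ∈⊤
    ; connected = λ { {zero} {zero} _ _ → ε }
    ; acyclic   = λ C → ∉⊥ (Cycle.close C)
    }
  ; spanning      = refl
  ; bag           = λ _ → V H
  ; bag⊆V         = λ _ p → p
  ; vertexCovered = λ p → zero , p
  ; edgeCovered   = λ p → zero , nbrs⊆V H (symmetric H p) , nbrs⊆V H p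
  ; coherent      = λ { {s = zero} {t = zero} _ _ → ε }
  }
  where
  K₁ : Graph 1
  K₁ = record
    { V           = ⊤
    ; nbrs        = λ _ → ⊥
    ; nbrs⊆V      = λ p → ⊥-elim (∉⊥ p)
    ; symmetric   = λ p → ⊥-elim (∉⊥ p)
    ; irreflexive = ∉⊥
    }

treeWidth-exists : ∀ {N} (H : Graph N) → ¬ ¬ ∃ (IsTreeWidth H)
treeWidth-exists H none = <-rec (λ m → ∀ D → ¬ (maxBag D ≡ m)) step
  _ (trivialDecomposition H) refl
  where
  step : ∀ m → (∀ {k} → k < m → (D : TreeDecomposition H) → ¬ (maxBag D ≡ k)) →
         (D : TreeDecomposition H) → ¬ (maxBag D ≡ m)
  step m smaller D refl = none (width D , (D , refl) , λ D′ →
    ℤ.⊖-monoˡ-≤ 1 (ℕ.≮⇒≥ (λ lt → smaller lt D′ refl)))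

-- For d > 0, the inequality w ≥ n / √d - 1 of real numbers.

infix 4 _≥_/√_−1

_≥_/√_−1 : ℤ → ℕ → ℕ → Set
w ≥ n /√ d −1 =
  0ℤ ℤ.≤ w ℤ.+ 1ℤ × + (n * n) ℤ.≤ + d ℤ.* ((w ℤ.+ 1ℤ) ℤ.* (w ℤ.+ 1ℤ))

{-# OPTIONS --safe #-}
-- Let U be the set of vertices reachable from S₁ without meeting X, and suppose
-- that a tree decomposition of G[X] has only bags with fewer than n vertices.
-- An edge st of the tree divides X, up to bag s ∩ bag t, into two halves Y and
-- Z without edges between them. On a row that avoids bag s ∩ bag t, adjacent
-- vertices therefore lie in equal or consecutive members of the cyclic sequence
-- U, Y, rest of G - X, Z, so the number of U-Y edges is even on every triangle.
-- As near-triangulations have trivial first cohomology mod 2, the parity of the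
-- number of U-Y edges on a path from S₁ to S₂ is the same for all the crossings
-- in such a row, and likewise for columns. So it does not depend on the
-- crossing, and it is odd for exactly one of the two halves, since their sum
-- counts how often the crossing enters or leaves U. This orients each edge of
-- the tree. In the same way, a crossing that avoids bag t shows that some edge
-- points away from the node t, which is impossible in a finite tree.

module Submission where

open import Defs
open import Data.Bool.Base using (Bool; true; false; _∧_; _xor_; if_then_else_)
open import Data.Bool.Properties
  using (xor-same; xor-comm; xor-assoc; xor-identityʳ; ∧-distribˡ-xor; ∧-zeroʳ; ∧-identityʳ; ∧-comm)
import Data.Bool.Properties as Bool
open import Data.Bool.Solver using (module xor-∧-Solver)
open import Data.Empty using (⊥-elim)
open import Data.Fin.Base using (Fin; zero; suc; inject₁; fromℕ; fromℕ<; toℕ)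
import Data.Fin.Properties as Fin
open import Data.Fin.Subset using (Subset; _⊆_; _∪_; _─_)
open import Data.Fin.Subset using (_∈_; _∉_; _∩_; ∁; ∣_∣; inside; outside; Empty; Nonempty; ⊤)
open import Data.Fin.Subset.Properties
  using (_∈?_; x∉p⇒x∈∁p; ∣∁p∣≡n∸∣p∣; ∣p∣≤n; ∈⊤; nonempty?; x∈p∩q⁺; x∈p∩q⁻; x∈p∪q⁺; p∩q⊆p; p∩q⊆q; p─q⊆p)
open import Data.Integer.Base using (ℤ)
open import Data.Integer.Base as ℤ using (+_; 0ℤ; 1ℤ)
import Data.Integer.Properties as ℤ
open import Data.List.Base
  using (List; []; _∷_; _++_; length; filter; map; allFin; tabulate; cartesianProduct)
open import Data.List.Extrema.Nat using (xs≤max)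
open import Data.List.Membership.Propositional using () renaming (_∈_ to _∈ˡ_)
open import Data.List.Membership.Propositional.Properties
  using (∈-allFin; ∈-filter⁺; ∈-filter⁻; ∈-map⁺; ∈-++⁺ˡ; ∈-++⁺ʳ; ∈-tabulate⁺; ∈-tabulate⁻; ∈-cartesianProduct⁺)
open import Data.List.Membership.Setoid.Properties using (index-injective)
open import Data.List.Properties using (length-++; length-map; length-tabulate)
import Data.List.Relation.Unary.All as All
open import Data.List.Relation.Unary.All using ([]; _∷_)
open import Data.List.Relation.Unary.AllPairs using ([]; _∷_)
open import Data.List.Relation.Unary.Any using (here; there; index)
open import Data.List.Relation.Unary.Unique.Propositional using (Unique)
import Data.List.Relation.Unary.Unique.Propositional.Properties as Unique
open import Data.Nat.Base using (ℕ; _*_; _≤_)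
open import Data.Nat.Base using (zero; suc; _+_; _∸_; _<_; s≤s; z≤n)
open import Data.Nat.GeneralisedArithmetic using (iterate)
open import Data.Nat.Induction using (<-rec)
import Data.Nat.Properties as ℕ
open import Data.Nat.Tactic.RingSolver using (solve-∀)
open import Data.Product.Base using (Σ; _×_; _,_; ∃-syntax; proj₁; proj₂; uncurry; swap; map₂)
open import Data.Product.Properties using (,-injectiveˡ; ,-injectiveʳ)
open import Data.Sum.Base as Sum using (_⊎_; inj₁; inj₂)
open import Data.Vec.Base as Vec using ([]; _∷_; here; there)
open import Data.Vec.Properties using (lookup∘tabulate; []=⇒lookup; lookup⇒[]=)
open import Function.Base using (id; _∘_)
open import Function.Bundles using (mk⇔; Equivalence)
open import Function.Definitions using (Injective)
open import Level using (0ℓ)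
open import Relation.Binary.Construct.Closure.ReflexiveTransitive using (Star; ε; _◅_; _◅◅_; reverse)
open import Relation.Binary.Core using (Rel)
open import Relation.Binary.Definitions using (tri<; tri≈; tri>)
open import Relation.Binary.PropositionalEquality
open import Relation.Binary.Structures using (IsEquivalence)
open import Relation.Nullary using (¬_; Dec; yes; no; does; _×-dec_; _⊎-dec_; ¬?)
open import Relation.Nullary.Decidable using (dec-true; dec-false; does-⇔)
open import Relation.Unary using (Pred; Decidable)

private
  variable
    A B : Set

-- Sums modulo 2

⨁ : List A → (A → Bool) → Bool
⨁ []       f = false
⨁ (x ∷ xs) f = f x xor ⨁ xs f

⨁-cong : ∀ (xs : List A) {f g} → (∀ {x} → x ∈ˡ xs → f x ≡ g x) → ⨁ xs f ≡ ⨁ xs g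
⨁-cong []       eq = refl
⨁-cong (x ∷ xs) eq = cong₂ _xor_ (eq (here refl)) (⨁-cong xs (eq ∘ there))

⨁-false : ∀ (xs : List A) {f} → (∀ {x} → x ∈ˡ xs → f x ≡ false) → ⨁ xs f ≡ false
⨁-false []       eq = refl
⨁-false (x ∷ xs) eq = cong₂ _xor_ (eq (here refl)) (⨁-false xs (eq ∘ there))

xor-interchange : ∀ a b c d → (a xor b) xor (c xor d) ≡ (a xor c) xor (b xor d)
xor-interchange = solve 4 (λ a b c d → (a :+ b) :+ (c :+ d) := (a :+ c) :+ (b :+ d)) refl
  where open xor-∧-Solver

⨁-xor : ∀ (xs : List A) f g → ⨁ xs (λ x → f x xor g x) ≡ ⨁ xs f xor ⨁ xs g
⨁-xor []       f g = refl
⨁-xor (x ∷ xs) f g = trans (cong ((f x xor g x) xor_) (⨁-xor xs f g))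
                           (xor-interchange (f x) (g x) (⨁ xs f) (⨁ xs g))

⨁-∧ˡ : ∀ (xs : List A) b f → ⨁ xs (λ x → b ∧ f x) ≡ b ∧ ⨁ xs f
⨁-∧ˡ xs true  f = refl
⨁-∧ˡ xs false f = ⨁-false xs (λ _ → refl)

⨁-++ : ∀ (xs ys : List A) f → ⨁ (xs ++ ys) f ≡ ⨁ xs f xor ⨁ ys f
⨁-++ []       ys f = refl
⨁-++ (x ∷ xs) ys f = trans (cong (f x xor_) (⨁-++ xs ys f))
                           (sym (xor-assoc (f x) (⨁ xs f) (⨁ ys f)))

⨁-map : ∀ (h : B → A) xs f → ⨁ (map h xs) f ≡ ⨁ xs (f ∘ h)
⨁-map h []       f = refl
⨁-map h (x ∷ xs) f = cong (f (h x) xor_) (⨁-map h xs f)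

⨁-filter : ∀ {P : Pred A 0ℓ} (P? : Decidable P) xs f →
           ⨁ (filter P? xs) f ≡ ⨁ xs (λ x → does (P? x) ∧ f x)
⨁-filter P? []       f = refl
⨁-filter P? (x ∷ xs) f with P? x
... | yes _ = cong (f x xor_) (⨁-filter P? xs f)
... | no  _ = ⨁-filter P? xs f

⨁-swap : ∀ (xs : List A) (ys : List B) (f : A → B → Bool) →
         ⨁ xs (λ x → ⨁ ys (f x)) ≡ ⨁ ys (λ y → ⨁ xs (λ x → f x y))
⨁-swap []       ys f = sym (⨁-false ys (λ _ → refl))
⨁-swap (x ∷ xs) ys f = trans (cong (⨁ ys (f x) xor_) (⨁-swap xs ys f))
                             (sym (⨁-xor ys (f x) (λ y → ⨁ xs (λ x → f x y))))

⨁-cartesianProduct : ∀ (xs : List A) (ys : List B) f →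
  ⨁ (cartesianProduct xs ys) f ≡ ⨁ xs (λ x → ⨁ ys (λ y → f (x , y)))
⨁-cartesianProduct []       ys f = refl
⨁-cartesianProduct (x ∷ xs) ys f =
  trans (⨁-++ (map (x ,_) ys) (cartesianProduct xs ys) f)
        (cong₂ _xor_ (⨁-map (x ,_) ys f) (⨁-cartesianProduct xs ys f))

-- An injective `g` in place of the identity keeps the induction going: the tail of `tabulate g` is
-- `tabulate (g ∘ suc)`.
⨁-tabulate-δ : ∀ {n m} (g : Fin m → Fin n) (c : Fin m) →
  (∀ {x y} → g x ≡ g y → x ≡ y) → (f : Fin n → Bool) →
  ⨁ (tabulate g) (λ k → does (g c Fin.≟ k) ∧ f k) ≡ f (g c)
⨁-tabulate-δ g zero inj f
  rewrite dec-true (g zero Fin.≟ g zero) refl =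
  trans (cong (f (g zero) xor_) (⨁-false _ λ k∈ → others k∈)) (xor-identityʳ _)
  where
  others : ∀ {k} → k ∈ˡ tabulate (g ∘ suc) → does (g zero Fin.≟ k) ∧ f k ≡ false
  others k∈ with ∈-tabulate⁻ k∈
  ... | i , refl rewrite dec-false (g zero Fin.≟ g (suc i)) (λ eq → Fin.0≢1+n (inj eq)) = refl
⨁-tabulate-δ g (suc c) inj f
  rewrite dec-false (g (suc c) Fin.≟ g zero) (λ eq → Fin.0≢1+n (sym (inj eq))) =
  ⨁-tabulate-δ (g ∘ suc) c (Fin.suc-injective ∘ inj) f

⨁-allFin-δ : ∀ {n} (c : Fin n) f → ⨁ (allFin n) (λ k → does (c Fin.≟ k) ∧ f k) ≡ f c
⨁-allFin-δ c = ⨁-tabulate-δ id c id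

enumeration-length : ∀ {n} (xs : List (Fin n)) → (∀ x → x ∈ˡ xs) → n ≤ length xs
enumeration-length xs ∈xs = Fin.injective⇒≤ {f = λ x → index (∈xs x)}
  (λ {x} {y} eq → index-injective (setoid _) (∈xs x) (∈xs y) eq)

-- Union-find on edge lists

does⇒ : ∀ {P : Set} (P? : Dec P) → does P? ≡ true → P
does⇒ (yes p) _ = p

-- The ends of an edge are parameters, so that one edge list can be read both as a graph on the
-- vertices and as its dual graph on the faces.
module UnionFind {E : Set} {n : ℕ} (src tgt : E → Fin n) where

  merge : (Fin n → Fin n) → Fin n → Fin n → Fin n → Fin n
  merge p u v x = if does (p x Fin.≟ p u) then p v else p x

  class : List E → Fin n → Fin n
  class []       = id
  class (e ∷ es) = merge (class es) (src e) (tgt e)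

  -- The list is processed from its end: a chord closes a cycle with later edges.
  chord? : ∀ e es → Dec (class es (src e) ≡ class es (tgt e))
  chord? e es = class es (src e) Fin.≟ class es (tgt e)

  chords : List E → List E
  chords []       = []
  chords (e ∷ es) = if does (chord? e es) then e ∷ chords es else chords es

  -- The size of the spanning forest that the non-chords form.
  rank : List E → ℕ
  rank []       = 0
  rank (e ∷ es) = if does (chord? e es) then rank es else suc (rank es)

  rank+chords : ∀ es → length es ≡ rank es + length (chords es)
  rank+chords []       = refl
  rank+chords (e ∷ es) with chord? e es
  ... | yes _ = trans (cong suc (rank+chords es)) (sym (ℕ.+-suc _ _))
  ... | no  _ = cong suc (rank+chords es)

  merge-cong : ∀ p u v {x y} → p x ≡ p y → merge p u v x ≡ merge p u v y
  merge-cong p u v eq = cong (λ z → if does (z Fin.≟ p u) then p v else z) eq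

  merge-joins : ∀ p u v → merge p u v u ≡ merge p u v v
  merge-joins p u v rewrite dec-true (p u Fin.≟ p u) refl with p v Fin.≟ p u
  ... | yes _ = refl
  ... | no  _ = refl

  class-edge : ∀ {e} es → e ∈ˡ es → class es (src e) ≡ class es (tgt e)
  class-edge (e ∷ es) (here refl) = merge-joins (class es) (src e) (tgt e)
  class-edge (e ∷ es) (there e∈)  = merge-cong (class es) (src e) (tgt e) (class-edge es e∈)

  module _ {_~_ : Rel (Fin n) 0ℓ} (~-equiv : IsEquivalence _~_) where
    private module ~ = IsEquivalence ~-equiv

    -- A merge identifies only what its edge forces. With a reflexive-transitive closure for `_~_`,
    -- equal labels yield a walk.
    class-least : ∀ es → (∀ {e} → e ∈ˡ es → src e ~ tgt e) →
                  ∀ {x y} → class es x ≡ class es y → x ~ y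
    class-least []       joined refl = ~.refl
    class-least (e ∷ es) joined {x} {y} eq
      with class es x Fin.≟ class es (src e) | class es y Fin.≟ class es (src e)
    ... | yes p | yes q = class-least es (joined ∘ there) (trans p (sym q))
    ... | yes p | no  q = ~.trans (class-least es (joined ∘ there) p)
                            (~.trans (joined (here refl)) (class-least es (joined ∘ there) eq))
    ... | no  p | yes q = ~.sym (~.trans (class-least es (joined ∘ there) q)
                            (~.trans (joined (here refl)) (class-least es (joined ∘ there) (sym eq))))
    ... | no  p | no  q = class-least es (joined ∘ there) eq

  rank-bound : ∀ es ls → (∀ x → class es x ∈ˡ ls) → n ≤ rank es + length ls
  rank-bound []       ls cover = enumeration-length ls cover
  rank-bound (e ∷ es) ls cover with chord? e es
  ... | yes p = rank-bound es ls λ x → subst (_∈ˡ ls) (same x) (cover x)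
    where
    same : ∀ x → class (e ∷ es) x ≡ class es x
    same x with class es x Fin.≟ class es (src e)
    ... | yes q = trans (sym p) (sym q)
    ... | no  _ = refl
  ... | no _ = subst (n ≤_) (ℕ.+-suc _ _) (rank-bound es (class es (src e) ∷ ls) cover′)
    where
    cover′ : ∀ x → class es x ∈ˡ class es (src e) ∷ ls
    cover′ x with class es x Fin.≟ class es (src e) | cover x
    ... | yes q | _ = here q
    ... | no  _ | c = there c

  -- On a forest a potential can be built edge by edge. A new edge joins two components, and adding
  -- the error `k` on the component of its source corrects the value there without disturbing the
  -- other edges.
  chordless-exact : ∀ es → chords es ≡ [] → (θ : E → Bool) →
    Σ (Fin n → Bool) λ φ → ∀ {e} → e ∈ˡ es → θ e ≡ φ (src e) xor φ (tgt e)
  chordless-exact []       _  θ = (λ _ → false) , λ ()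
  chordless-exact (e ∷ es) eq θ with chord? e es
  chordless-exact (e ∷ es) () θ | yes _
  chordless-exact (e ∷ es) eq θ | no p with chordless-exact es eq θ
  ... | φ , exact = φ′ , exact′
    where
    k : Bool
    k = θ e xor (φ (src e) xor φ (tgt e))
    inSrc : Fin n → Bool
    inSrc c = does (c Fin.≟ class es (src e)) ∧ k
    φ′ : Fin n → Bool
    φ′ x = φ x xor inSrc (class es x)
    cancel : ∀ a b c → a ≡ (b xor (a xor (b xor c))) xor (c xor false)
    cancel true  true  true  = refl
    cancel true  true  false = refl
    cancel true  false true  = refl
    cancel true  false false = refl
    cancel false true  true  = refl
    cancel false true  false = refl
    cancel false false true  = refl
    cancel false false false = refl
    exact′ : ∀ {e′} → e′ ∈ˡ e ∷ es → θ e′ ≡ φ′ (src e′) xor φ′ (tgt e′)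
    exact′ (here refl)
      rewrite dec-true (class es (src e) Fin.≟ class es (src e)) refl
            | dec-false (class es (tgt e) Fin.≟ class es (src e)) (p ∘ sym) =
      cancel (θ e) (φ (src e)) (φ (tgt e))
    exact′ {e′} (there e∈) rewrite class-edge es e∈ =
      trans (exact e∈) (shift (φ (src e′)) (φ (tgt e′)) (inSrc (class es (tgt e′))))
      where
      shift : ∀ a b c → a xor b ≡ (a xor c) xor (b xor c)
      shift a b c = sym (trans (xor-interchange a c b c)
                          (trans (cong ((a xor b) xor_) (xor-same c)) (xor-identityʳ _)))

  -- Being a cycle mod 2, tested on cuts: every cut contains evenly many edges of `θ`.
  Balanced : List E → (E → Bool) → Set
  Balanced es θ = ∀ (χ : Fin n → Bool) → ⨁ es (λ e → θ e ∧ (χ (src e) xor χ (tgt e))) ≡ false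

  balanced-false : ∀ es θ → Balanced es θ → (∀ {e} → e ∈ˡ chords es → θ e ≡ false) →
                   ∀ {e} → e ∈ˡ es → θ e ≡ false
  balanced-false (e ∷ es) θ bal zeros = λ where
      (here refl) → θe
      (there e∈)  → balanced-false es θ bal′ (zeros ∘ chords-there) e∈
    where
    chords-there : ∀ {e′} → e′ ∈ˡ chords es → e′ ∈ˡ chords (e ∷ es)
    chords-there e∈ with chord? e es
    ... | yes _ = there e∈
    ... | no  _ = e∈

    inSrc : Fin n → Bool
    inSrc x = does (class es x Fin.≟ class es (src e))

    cancels : ∀ {e′} → e′ ∈ˡ es → θ e′ ∧ (inSrc (src e′) xor inSrc (tgt e′)) ≡ false
    cancels {e′} e∈ rewrite class-edge es e∈ | xor-same (inSrc (tgt e′)) = ∧-zeroʳ _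

    separated : ¬ (class es (src e) ≡ class es (tgt e)) → inSrc (src e) xor inSrc (tgt e) ≡ true
    separated p = cong₂ _xor_ (dec-true (class es (src e) Fin.≟ _) refl)
                              (dec-false (class es (tgt e) Fin.≟ _) (p ∘ sym))

    θe : θ e ≡ false
    θe with chord? e es | zeros {e}
    ... | yes _ | z = z (here refl)
    ... | no p  | _ = begin
      θ e                                          ≡⟨ ∧-identityʳ (θ e) ⟨
      θ e ∧ true                                   ≡⟨ cong (θ e ∧_) (separated p) ⟨
      θ e ∧ (inSrc (src e) xor inSrc (tgt e))      ≡⟨ xor-identityʳ _ ⟨
      θ e ∧ (inSrc (src e) xor inSrc (tgt e)) xor false
        ≡⟨ cong (θ e ∧ (inSrc (src e) xor inSrc (tgt e)) xor_) (⨁-false es cancels) ⟨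
      ⨁ (e ∷ es) (λ e → θ e ∧ (inSrc (src e) xor inSrc (tgt e))) ≡⟨ bal inSrc ⟩
      false                                        ∎
      where open ≡-Reasoning

    bal′ : Balanced es θ
    bal′ χ = trans (cong (λ b → b ∧ (χ (src e) xor χ (tgt e)) xor
                            ⨁ es (λ e → θ e ∧ (χ (src e) xor χ (tgt e)))) (sym θe)) (bal χ)

elements : ∀ {n} → Subset n → List (Fin n)
elements []            = []
elements (inside  ∷ p) = zero ∷ map suc (elements p)
elements (outside ∷ p) = map suc (elements p)

length-elements : ∀ {n} (p : Subset n) → length (elements p) ≡ ∣ p ∣
length-elements []            = refl
length-elements (inside  ∷ p) = cong suc (trans (length-map suc (elements p)) (length-elements p))
length-elements (outside ∷ p) = trans (length-map suc (elements p)) (length-elements p)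

∈-elements : ∀ {n x} (p : Subset n) → x ∈ p → x ∈ˡ elements p
∈-elements (inside  ∷ p) here       = here refl
∈-elements (inside  ∷ p) (there x∈) = there (∈-map⁺ suc (∈-elements p x∈))
∈-elements (outside ∷ p) (there x∈) = ∈-map⁺ suc (∈-elements p x∈)

xor-false : ∀ {a b} → a xor b ≡ false → a ≡ b
xor-false {true}  {true}  _ = refl
xor-false {false} {false} _ = refl

-- Cohomology of near-triangulations

module _ {N} (H : Graph N) where

  adjacent⇒≢ : ∀ {u v} → H ⊢ u ~ v → u ≢ v
  adjacent⇒≢ u~v refl = irreflexive H u~v

  ∈-darts⁺ : ∀ {u v} → H ⊢ u ~ v → (u , v) ∈ˡ darts H
  ∈-darts⁺ = ∈-filter⁺ _ (∈-cartesianProduct⁺ (∈-allFin _) (∈-allFin _))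

  ∈-darts⁻ : ∀ {u v} → (u , v) ∈ˡ darts H → H ⊢ u ~ v
  ∈-darts⁻ = proj₂ ∘ ∈-filter⁻ (λ (u , v) → v ∈? nbrs H u)
                       {xs = cartesianProduct (allFin N) (allFin N)}

  unique-darts : Unique (darts H)
  unique-darts = Unique.filter⁺ _ (Unique.cartesianProduct⁺ (Unique.allFin⁺ N) (Unique.allFin⁺ N))

  -- Its length is `#edges H` by definition, which is the number that `euler` speaks of.
  edgeList : List (Fin N × Fin N)
  edgeList = filter (λ (u , v) → u Fin.<? v) (darts H)

  symmetric-on-edges : ∀ (R : Fin N → Fin N → Set) → (∀ {u v} → R u v → R v u) →
    (∀ {u v} → (u , v) ∈ˡ edgeList → R u v) → ∀ {u v} → H ⊢ u ~ v → R u v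
  symmetric-on-edges R R-sym on-edges {u} {v} u~v with Fin.<-cmp u v
  ... | tri< u<v _ _ = on-edges (∈-filter⁺ _ (∈-darts⁺ u~v) u<v)
  ... | tri≈ _ u≡v _ = ⊥-elim (adjacent⇒≢ u~v u≡v)
  ... | tri> _ _ v<u = R-sym (on-edges (∈-filter⁺ _ (∈-darts⁺ (symmetric H u~v)) v<u))

  ⨁-darts : ∀ F → ⨁ (darts H) F ≡ ⨁ (allFin N) λ u → ⨁ (allFin N) λ v → does (v ∈? nbrs H u) ∧ F (u , v)
  ⨁-darts F = trans (⨁-filter (λ (u , v) → v ∈? nbrs H u) (cartesianProduct (allFin N) (allFin N)) F)
                    (⨁-cartesianProduct (allFin N) (allFin N) _)

  ⨁-edges-both-directions : ∀ F → ⨁ edgeList (λ (u , v) → F (u , v) xor F (v , u)) ≡ ⨁ (darts H) F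
  ⨁-edges-both-directions F = begin
    ⨁ edgeList (λ d → F d xor F (swap d))
      ≡⟨ ⨁-filter (λ (u , v) → u Fin.<? v) (darts H) _ ⟩
    ⨁ (darts H) (λ (u , v) → lt u v ∧ (F (u , v) xor F (v , u)))
      ≡⟨ ⨁-cong (darts H) (λ {(u , v)} _ → ∧-distribˡ-xor (lt u v) (F (u , v)) (F (v , u))) ⟩
    ⨁ (darts H) (λ (u , v) → (lt u v ∧ F (u , v)) xor (lt u v ∧ F (v , u)))
      ≡⟨ ⨁-xor (darts H) _ _ ⟩
    ⨁ (darts H) (λ (u , v) → lt u v ∧ F (u , v)) xor ⨁ (darts H) (λ (u , v) → lt u v ∧ F (v , u))
      ≡⟨ cong (⨁ (darts H) (λ (u , v) → lt u v ∧ F (u , v)) xor_) reversed ⟩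
    ⨁ (darts H) (λ (u , v) → lt u v ∧ F (u , v)) xor ⨁ (darts H) (λ (u , v) → lt v u ∧ F (u , v))
      ≡⟨ ⨁-xor (darts H) _ _ ⟨
    ⨁ (darts H) (λ (u , v) → (lt u v ∧ F (u , v)) xor (lt v u ∧ F (u , v)))
      ≡⟨ ⨁-cong (darts H) (λ d∈ → one-direction (∈-darts⁻ d∈)) ⟩
    ⨁ (darts H) F ∎
    where
    open ≡-Reasoning
    lt : Fin N → Fin N → Bool
    lt u v = does (u Fin.<? v)

    reversed : ⨁ (darts H) (λ (u , v) → lt u v ∧ F (v , u)) ≡
               ⨁ (darts H) (λ (u , v) → lt v u ∧ F (u , v))
    reversed = begin
      ⨁ (darts H) (λ (u , v) → lt u v ∧ F (v , u))
        ≡⟨ ⨁-darts _ ⟩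
      ⨁ (allFin N) (λ u → ⨁ (allFin N) λ v → does (v ∈? nbrs H u) ∧ (lt u v ∧ F (v , u)))
        ≡⟨ ⨁-swap (allFin N) (allFin N) _ ⟩
      ⨁ (allFin N) (λ v → ⨁ (allFin N) λ u → does (v ∈? nbrs H u) ∧ (lt u v ∧ F (v , u)))
        ≡⟨ ⨁-cong (allFin N) (λ {v} _ → ⨁-cong (allFin N) (λ {u} _ → cong (_∧ (lt u v ∧ F (v , u)))
             (does-⇔ (mk⇔ (symmetric H) (symmetric H)) (v ∈? nbrs H u) (u ∈? nbrs H v)))) ⟩
      ⨁ (allFin N) (λ v → ⨁ (allFin N) λ u → does (u ∈? nbrs H v) ∧ (lt u v ∧ F (v , u)))
        ≡⟨ ⨁-darts _ ⟨
      ⨁ (darts H) (λ (u , v) → lt v u ∧ F (u , v)) ∎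

    one-direction : ∀ {u v} → H ⊢ u ~ v → (lt u v ∧ F (u , v)) xor (lt v u ∧ F (u , v)) ≡ F (u , v)
    one-direction {u} {v} u~v with Fin.<-cmp u v
    ... | tri< u<v _ v≮u rewrite dec-true (u Fin.<? v) u<v | dec-false (v Fin.<? u) v≮u = xor-identityʳ _
    ... | tri≈ _ u≡v _ = ⊥-elim (adjacent⇒≢ u~v u≡v)
    ... | tri> u≮v _ v<u rewrite dec-false (u Fin.<? v) u≮v | dec-true (v Fin.<? u) v<u = refl

  -- The cocycle condition mod 2, imposed on all triangles of `H` and not only on the facial ones.
  EvenOnTriangles : (Fin N → Fin N → Bool) → Set
  EvenOnTriangles θ = ∀ {u v w} → H ⊢ u ~ v → H ⊢ v ~ w → H ⊢ w ~ u →
                      θ u v xor (θ v w xor θ w u) ≡ false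

⨁-fibres : ∀ {A : Set} {k} (g : A → Fin k) (xs : List A) F →
           ⨁ xs F ≡ ⨁ (allFin k) λ c → ⨁ (filter (λ x → g x Fin.≟ c) xs) F
⨁-fibres {k = k} g xs F = begin
  ⨁ xs F
    ≡⟨ ⨁-cong xs (λ {x} _ → ⨁-allFin-δ (g x) (λ _ → F x)) ⟨
  ⨁ xs (λ x → ⨁ (allFin k) λ c → does (g x Fin.≟ c) ∧ F x)
    ≡⟨ ⨁-swap xs (allFin k) _ ⟩
  ⨁ (allFin k) (λ c → ⨁ xs λ x → does (g x Fin.≟ c) ∧ F x)
    ≡⟨ ⨁-cong (allFin k) (λ {c} _ → ⨁-filter (λ x → g x Fin.≟ c) xs F) ⟨
  ⨁ (allFin k) (λ c → ⨁ (filter (λ x → g x Fin.≟ c) xs) F)  ∎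
  where open ≡-Reasoning

module _ {N} {H : Graph N} (T : NearTriangulation H) where
  open NearTriangulation T

  -- The rotation at `u` is a single cycle, so a fixed point means that `u` has degree one.
  rot-fixed : ∀ {u v w} → H ⊢ u ~ v → rot u v ≡ v → H ⊢ u ~ w → w ≡ v
  rot-fixed {u} {v} u~v fixed u~w with rot-cyclic u~v u~w
  ... | k , refl = stays k v fixed
    where
    stays : ∀ k x → rot u x ≡ x → iterate (rot u) x k ≡ x
    stays zero    x fix = refl
    stays (suc k) x fix = trans (cong (λ y → iterate (rot u) y k) fix) (stays k x fix)

  next : Fin N × Fin N → Fin N × Fin N
  next (u , v) = v , rot v u

  -- A face of length three is a triangle: next has no fixed point on it, and
  -- it cannot swap two darts, for the third would then have nowhere to go.
  even-on-3-cycle : ∀ θ → EvenOnTriangles H θ → ∀ {a b c} → a ≢ c → b ≢ c →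
    (∀ {u v} → (u , v) ∈ˡ a ∷ b ∷ c ∷ [] → H ⊢ u ~ v) →
    (∀ {d} → d ∈ˡ a ∷ b ∷ c ∷ [] → next d ∈ˡ a ∷ b ∷ c ∷ []) →
    next a ≡ b → uncurry θ a xor (uncurry θ b xor uncurry θ c) ≡ false
  even-on-3-cycle θ even {u , v} {_} {c} a≢c b≢c adj closed refl
    with adj (here refl) | adj (there (here refl)) | closed (there (here refl))
  ... | u~v | v~w | there (here eq) = ⊥-elim (adjacent⇒≢ H v~w (sym (,-injectiveˡ eq)))
  ... | u~v | v~w | there (there (here refl))
    with closed (there (there (here refl))) | adj (there (there (here refl)))
  ...   | here eq | w~x rewrite ,-injectiveˡ eq = even u~v v~w w~x
  ...   | there (here eq) | w~x = ⊥-elim (a≢c (cong₂ _,_ u≡w (sym x≡v)))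
    where
    x≡v : rot (rot v u) v ≡ v
    x≡v = ,-injectiveˡ eq
    u≡w : u ≡ rot v u
    u≡w = rot-fixed v~w (subst (λ y → rot y (rot v u) ≡ rot v u) x≡v (,-injectiveʳ eq)) (symmetric H u~v)
  ...   | there (there (here eq)) | w~x = ⊥-elim (adjacent⇒≢ H w~x (sym (,-injectiveˡ eq)))
  even-on-3-cycle θ even {u , v} {_} {p , q} a≢c b≢c adj closed refl
      | u~v | v~w | here eq with closed (there (there (here refl))) | adj (there (there (here refl)))
  ...   | here eq′ | p~q = ⊥-elim (b≢c (cong₂ _,_ (sym p≡v) (trans (,-injectiveˡ eq) (sym q≡u))))
    where
    q≡u : q ≡ u
    q≡u = ,-injectiveˡ eq′
    p≡v : p ≡ v
    p≡v = rot-fixed u~v (trans (cong (λ y → rot y v) (sym (,-injectiveˡ eq))) (,-injectiveʳ eq))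
                    (subst (H ⊢_~ p) q≡u (symmetric H p~q))
  ...   | there (here eq′) | p~q = ⊥-elim (a≢c (cong₂ _,_ (sym p≡u) (sym q≡v)))
    where
    q≡v : q ≡ v
    q≡v = ,-injectiveˡ eq′
    p≡u : p ≡ u
    p≡u = rot-fixed (symmetric H u~v) (,-injectiveˡ eq) (subst (H ⊢_~ p) q≡v (symmetric H p~q))
  ...   | there (there (here eq′)) | p~q = ⊥-elim (adjacent⇒≢ H p~q (sym (,-injectiveˡ eq′)))

  face : Fin #faces → List (Fin N × Fin N)
  face f = filter (λ (u , v) → left u v Fin.≟ f) (darts H)

  even-on-inner-face : ∀ θ → EvenOnTriangles H θ → ∀ {f} → f ≢ outer → ⨁ (face f) (uncurry θ) ≡ false
  even-on-inner-face θ even {f} f≢outer =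
    on-three (face f) (inner f≢outer) (Unique.filter⁺ _ (unique-darts H))
      (∈-darts⁻ H ∘ proj₁ ∘ ∈-face⁻)
      (λ d∈ → let d∈H , on-f = ∈-face⁻ d∈ in ∈-filter⁺ _
        (∈-darts⁺ H (rot-closed (symmetric H (∈-darts⁻ H d∈H))))
        (trans (sym (left-next (∈-darts⁻ H d∈H))) on-f))
    where
    ∈-face⁻ : ∀ {d} → d ∈ˡ face f → d ∈ˡ darts H × uncurry left d ≡ f
    ∈-face⁻ = ∈-filter⁻ (λ (u , v) → left u v Fin.≟ f) {xs = darts H}

    on-three : ∀ ds → length ds ≡ 3 → Unique ds →
      (∀ {u v} → (u , v) ∈ˡ ds → H ⊢ u ~ v) → (∀ {d} → d ∈ˡ ds → next d ∈ˡ ds) →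
      ⨁ ds (uncurry θ) ≡ false
    on-three (a ∷ b ∷ c ∷ []) refl ((a≢b ∷ a≢c ∷ []) ∷ (b≢c ∷ []) ∷ [] ∷ []) adj closed
      rewrite xor-identityʳ (uncurry θ c) with closed (here refl)
    ... | here eq = ⊥-elim (adjacent⇒≢ H (adj (here refl)) (sym (,-injectiveˡ eq)))
    ... | there (here eq) = even-on-3-cycle θ even a≢c b≢c adj closed eq
    -- The list names the darts against the order of the facial walk, so its last two entries are
    -- exchanged.
    ... | there (there (here eq)) =
      trans (cong (uncurry θ a xor_) (xor-comm (uncurry θ b) (uncurry θ c)))
            (even-on-3-cycle θ even a≢b (b≢c ∘ sym) (adj ∘ rotate) (rotate ∘ closed ∘ rotate) eq)
      where
      rotate : ∀ {A : Set} {x y z d : A} → d ∈ˡ x ∷ y ∷ z ∷ [] → d ∈ˡ x ∷ z ∷ y ∷ []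
      rotate (here eq)                 = here eq
      rotate (there (here eq))         = there (there (here eq))
      rotate (there (there (here eq))) = there (here eq)

  -- A spanning tree of the dual graph and its complement

  module Primal = UnionFind {E = Fin N × Fin N} proj₁ proj₂
  module Dual   = UnionFind {E = Fin N × Fin N} (uncurry left) (uncurry left ∘ swap)

  -- Grouped by the face on the left, the sum over darts is a sum over faces of `χ₀ f` times the sum
  -- of `θ` around `f`. The second factor vanishes on inner faces, which are triangles, and the
  -- first on the outer face.
  balanced : ∀ θ → (∀ u v → θ u v ≡ θ v u) → EvenOnTriangles H θ →
             Dual.Balanced (edgeList H) (uncurry θ)
  balanced θ θ-sym even χ = begin
    ⨁ (edgeList H) (λ (u , v) → θ u v ∧ (χ (left u v) xor χ (left v u)))
      ≡⟨ ⨁-cong (edgeList H) (λ {(u , v)} _ → both-sides u v) ⟩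
    ⨁ (edgeList H) (λ d → F d xor F (swap d))
      ≡⟨ ⨁-edges-both-directions H F ⟩
    ⨁ (darts H) F
      ≡⟨ ⨁-fibres (uncurry left) (darts H) F ⟩
    ⨁ (allFin _) (λ f → ⨁ (face f) F)
      ≡⟨ ⨁-false (allFin _) (λ {f} _ → on-face f) ⟩
    false ∎
    where
    open ≡-Reasoning
    -- Adding the constant `χ outer` keeps all differences of `χ` and makes the outer face drop out.
    χ₀ : Fin #faces → Bool
    χ₀ f = χ f xor χ outer

    F : Fin N × Fin N → Bool
    F (u , v) = χ₀ (left u v) ∧ θ u v

    both-sides : ∀ u v → θ u v ∧ (χ (left u v) xor χ (left v u)) ≡ F (u , v) xor F (v , u)
    both-sides u v rewrite θ-sym v u = algebra (θ u v) (χ (left u v)) (χ (left v u)) (χ outer)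
      where
      open xor-∧-Solver
      algebra : ∀ t a b c → t ∧ (a xor b) ≡ ((a xor c) ∧ t) xor ((b xor c) ∧ t)
      algebra = solve 4 (λ t a b c → t :* (a :+ b) := ((a :+ c) :* t) :+ ((b :+ c) :* t)) refl

    on-face : ∀ f → ⨁ (face f) F ≡ false
    on-face f = begin
      ⨁ (face f) F                       ≡⟨ ⨁-cong (face f) (λ {(u , v)} d∈ →
          cong (λ g → χ₀ g ∧ θ u v) (proj₂ (∈-filter⁻ (λ (u , v) → left u v Fin.≟ f) {xs = darts H} d∈))) ⟩
      ⨁ (face f) (λ d → χ₀ f ∧ uncurry θ d)  ≡⟨ ⨁-∧ˡ (face f) (χ₀ f) (uncurry θ) ⟩
      χ₀ f ∧ ⨁ (face f) (uncurry θ)      ≡⟨ vanishes ⟩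
      false ∎
      where
      vanishes : χ₀ f ∧ ⨁ (face f) (uncurry θ) ≡ false
      vanishes with f Fin.≟ outer
      ... | yes refl = cong (_∧ ⨁ (face f) (uncurry θ)) (xor-same (χ f))
      ... | no f≢outer = trans (cong (χ₀ f ∧_) (even-on-inner-face θ even f≢outer)) (∧-zeroʳ _)

  -- The edges other than the chords form a spanning tree of the dual graph, so an even
  -- cochain that vanishes on the chords is killed by removing the dual leaves one by one.
  determined-by-chords : ∀ θ → (∀ u v → θ u v ≡ θ v u) → EvenOnTriangles H θ →
    (∀ {u v} → (u , v) ∈ˡ Dual.chords (edgeList H) → θ u v ≡ false) → ∀ {u v} → H ⊢ u ~ v → θ u v ≡ false
  determined-by-chords θ θ-sym even zeros = symmetric-on-edges H (λ u v → θ u v ≡ false)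
    (λ {u} {v} eq → trans (θ-sym v u) eq)
    (Dual.balanced-false (edgeList H) (uncurry θ) (balanced θ θ-sym even) zeros)

  coboundary : (Fin N → Bool) → Fin N → Fin N → Bool
  coboundary φ u v = φ u xor φ v

  coboundary-sym : ∀ φ u v → coboundary φ u v ≡ coboundary φ v u
  coboundary-sym φ u v = xor-comm (φ u) (φ v)

  coboundary-even : ∀ φ → EvenOnTriangles H (coboundary φ)
  coboundary-even φ {u} {v} {w} _ _ _ = algebra (φ u) (φ v) (φ w)
    where
    open xor-∧-Solver
    algebra : ∀ a b c → (a xor b) xor ((b xor c) xor (c xor a)) ≡ false
    algebra = solve 3 (λ a b c → (a :+ b) :+ ((b :+ c) :+ (c :+ a)) := con false) refl

  coForest : List (Fin N × Fin N)
  coForest = Dual.chords (edgeList H)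

  component : Fin N → Fin N
  component = Primal.class coForest

  -- The indicator of a class of `coForest` has a coboundary that vanishes on `coForest`, hence on
  -- all of `H`. So no edge of `H` leaves the class.
  component-constant : ∀ {u v} → Linked H u v → component u ≡ component v
  component-constant ε = refl
  component-constant {u} (_◅_ {j = v} u~v rest) = trans (adjacent u~v) (component-constant rest)
    where
    inClass : Fin N → Bool
    inClass x = does (component x Fin.≟ component u)
    inClass-u : inClass u ≡ true
    inClass-u = dec-true (component u Fin.≟ component u) refl
    zeros : ∀ {x y} → (x , y) ∈ˡ coForest → coboundary inClass x y ≡ false
    zeros {x} {y} e∈ = trans
      (cong (λ c → does (c Fin.≟ component u) xor inClass y) (Primal.class-edge coForest e∈))
      (xor-same (inClass y))
    adjacent : ∀ {v} → H ⊢ u ~ v → component u ≡ component v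
    adjacent {v} u~v = sym (does⇒ (component v Fin.≟ component u) (trans (sym
      (xor-false (determined-by-chords (coboundary inClass) (coboundary-sym inClass)
                    (coboundary-even inClass) zeros u~v)))
      inClass-u))

  faceClass : Fin #faces → Fin #faces
  faceClass = Dual.class (edgeList H)

  -- Crossing the edge from `u` to `v` leads to the face `left v u`, which is also the face of the
  -- dart from `u` to `rot u v`. Repeating this turns once around `u`.
  sameFaceClass : ∀ {u v w} → H ⊢ u ~ v → H ⊢ u ~ w → faceClass (left u v) ≡ faceClass (left u w)
  sameFaceClass {u} {v} u~v u~w with rot-cyclic u~v u~w
  ... | k , refl = turn k u~v
    where
    across : ∀ {u v} → H ⊢ u ~ v → faceClass (left u v) ≡ faceClass (left v u)
    across = symmetric-on-edges H (λ u v → faceClass (left u v) ≡ faceClass (left v u)) sym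
               (Dual.class-edge (edgeList H))
    turn : ∀ k {v} → H ⊢ u ~ v → faceClass (left u v) ≡ faceClass (left u (iterate (rot u) v k))
    turn zero    u~v = refl
    turn (suc k) u~v = trans (trans (across u~v) (cong faceClass (left-next (symmetric H u~v))))
                             (turn k (rot-closed u~v))

  -- Connectedness of the dual graph. Faces linked by `joined` share a vertex. Turning around it
  -- connects them, unless it is isolated and thus belongs to one face only.
  faceClass-constant : ∀ f g → faceClass f ≡ faceClass g
  faceClass-constant f g = along (joined f g)
    where
    incident : ∀ {f g v} → Incident f v → Incident g v → faceClass f ≡ faceClass g
    incident (inj₁ (_ , v~w , refl)) (inj₁ (_ , v~x , refl)) = sameFaceClass v~w v~x
    incident (inj₁ (_ , v~w , _)) (inj₂ (_ , isolated , _))  = ⊥-elim (isolated (_ , v~w))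
    incident (inj₂ (_ , isolated , _)) (inj₁ (_ , v~w , _))  = ⊥-elim (isolated (_ , v~w))
    incident (inj₂ (_ , _ , refl)) (inj₂ (_ , _ , refl))     = refl
    along : ∀ {f g} → Star (λ f g → ∃[ v ] (Incident f v × Incident g v)) f g → faceClass f ≡ faceClass g
    along ε                = refl
    along ((_ , i , j) ◅ s) = trans (incident i j) (along s)

  -- By Euler's formula, the complement of a dual spanning tree has exactly as
  -- many edges as a spanning forest, and it has the same components as H.
  coForest-chordless : Primal.chords coForest ≡ []
  coForest-chordless = empty (Primal.chords coForest) (ℕ.n≤0⇒n≡0 (arithmetic faces-bound vertices-bound
      (Dual.rank+chords (edgeList H)) (Primal.rank+chords coForest) (∣p∣≤n (V H)) euler))
    where
    open HasComponents components

    -- All of `Fin N` carries labels. Each component of `H` needs at most one, and so does each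
    -- index outside `V H`; the latter cancel against `N` in `arithmetic`.
    labels : List (Fin N)
    labels = tabulate (component ∘ root) ++ map component (elements (∁ (V H)))

    covered : ∀ x → component x ∈ˡ labels
    covered x with x ∈? V H
    ... | no x∉ = ∈-++⁺ʳ (tabulate (component ∘ root)) (∈-map⁺ component (∈-elements (∁ (V H)) (x∉p⇒x∈∁p x∉)))
    ... | yes x∈ with reached x∈
    ...   | i , link rewrite sym (component-constant link) = ∈-++⁺ˡ (∈-tabulate⁺ {f = component ∘ root} i)

    length-labels : length labels ≡ #components + (N ∸ ∣ V H ∣)
    length-labels = trans (length-++ (tabulate (component ∘ root))) (cong₂ _+_
      (length-tabulate (component ∘ root))
      (trans (length-map component (elements (∁ (V H))))
        (trans (length-elements (∁ (V H))) (∣∁p∣≡n∸∣p∣ (V H)))))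

    vertices-bound : N ≤ Primal.rank coForest + (#components + (N ∸ ∣ V H ∣))
    vertices-bound = subst (λ l → N ≤ Primal.rank coForest + l) length-labels
                       (Primal.rank-bound coForest labels covered)

    faces-bound : #faces ≤ Dual.rank (edgeList H) + 1
    faces-bound = Dual.rank-bound (edgeList H) (faceClass outer ∷ [])
                    (λ f → here (faceClass-constant f outer))

    empty : ∀ {A : Set} (xs : List A) → length xs ≡ 0 → xs ≡ []
    empty [] _ = refl

    arithmetic : ∀ {v f e c r k s h n} → f ≤ r + 1 → n ≤ s + (c + (n ∸ v)) → e ≡ r + k → k ≡ s + h →
                 v ≤ n → v + f ≡ e + (1 + c) → h ≤ 0
    arithmetic {v} {f} {_} {c} {r} {_} {s} {h} {n} f≤ n≤ refl refl v≤n eu =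
      ℕ.+-cancelˡ-≤ (s + c + (r + 1)) h 0 (begin
        s + c + (r + 1) + h     ≡⟨ lhs s c r h ⟩
        r + (s + h) + (1 + c)   ≡⟨ eu ⟨
        v + f                   ≤⟨ ℕ.+-mono-≤ v≤ f≤ ⟩
        s + c + (r + 1)         ≡⟨ ℕ.+-identityʳ _ ⟨
        s + c + (r + 1) + 0     ∎)
      where
      open ℕ.≤-Reasoning
      lhs : ∀ s c r h → s + c + (r + 1) + h ≡ r + (s + h) + (1 + c)
      lhs = solve-∀
      v≤ : v ≤ s + c
      v≤ = ℕ.+-cancelʳ-≤ (n ∸ v) v (s + c) (begin
        v + (n ∸ v)         ≡⟨ ℕ.m+[n∸m]≡n v≤n ⟩
        n                   ≤⟨ n≤ ⟩
        s + (c + (n ∸ v))   ≡⟨ ℕ.+-assoc s c (n ∸ v) ⟨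
        s + c + (n ∸ v)     ∎)

  -- First cohomology mod 2 vanishes. A potential is fitted to `θ` on the forest `coForest`; what
  -- remains of `θ` is even on triangles and zero on `coForest`, therefore zero.
  exact : ∀ {θ} → (∀ u v → θ u v ≡ θ v u) → EvenOnTriangles H θ →
          Σ (Fin N → Bool) λ φ → ∀ {u v} → H ⊢ u ~ v → θ u v ≡ φ u xor φ v
  exact {θ} θ-sym even with Primal.chordless-exact coForest coForest-chordless (uncurry θ)
  ... | φ , on-forest = φ , λ u~v → xor-false (determined-by-chords θ′ θ′-sym θ′-even
            (λ {u} {v} e∈ → trans (cong (_xor coboundary φ u v) (on-forest e∈))
                                  (xor-same (coboundary φ u v))) u~v)
    where
    θ′ : Fin N → Fin N → Bool
    θ′ u v = θ u v xor coboundary φ u v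
    θ′-sym : ∀ u v → θ′ u v ≡ θ′ v u
    θ′-sym u v = cong₂ _xor_ (θ-sym u v) (coboundary-sym φ u v)
    θ′-even : EvenOnTriangles H θ′
    θ′-even {u} {v} {w} u~v v~w w~u = trans (algebra (θ u v) _ (θ v w) _ (θ w u) _)
        (cong₂ _xor_ (even u~v v~w w~u) (coboundary-even φ u~v v~w w~u))
      where
      algebra : ∀ a a′ b b′ c c′ → (a xor a′) xor ((b xor b′) xor (c xor c′)) ≡
                                   (a xor (b xor c)) xor (a′ xor (b′ xor c′))
      algebra a a′ b b′ c c′ = trans (cong ((a xor a′) xor_) (xor-interchange b b′ c c′))
                                     (xor-interchange a a′ (b xor c) (b′ xor c′))

-- Walks and trees

record SimpleWalk {N} (R : Rel (Fin N) 0ℓ) (u v : Fin N) : Set where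
  field
    len       : ℕ
    seq       : Fin (suc len) → Fin N
    injective : Injective _≡_ _≡_ seq
    start     : seq zero ≡ u
    end       : seq (fromℕ len) ≡ v
    step      : ∀ i → R (seq (inject₁ i)) (seq (suc i))

module _ {N} {R : Rel (Fin N) 0ℓ} where
  open SimpleWalk

  tailFrom : ∀ {u v} (W : SimpleWalk R u v) i → SimpleWalk R (seq W i) v
  tailFrom record { len = l; seq = s; injective = inj; start = st; end = e; step = p } = go l s inj e p
    where
    go : ∀ {v} l (s : Fin (suc l) → Fin N) → Injective _≡_ _≡_ s → s (fromℕ l) ≡ v →
         (∀ i → R (s (inject₁ i)) (s (suc i))) → ∀ i → SimpleWalk R (s i) v
    go l s inj e p zero = record
      { len = l; seq = s; injective = inj; start = refl; end = e; step = p }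
    go (suc l) s inj e p (suc i) = go l (s ∘ suc) (Fin.suc-injective ∘ inj) e (p ∘ suc) i

  simpleWalk : ∀ {u v} → Star R u v → SimpleWalk R u v
  simpleWalk {u} ε = record
    { len = 0; seq = λ _ → u; injective = λ { {zero} {zero} _ → refl }
    ; start = refl; end = refl; step = λ () }
  simpleWalk {u} (_◅_ {j = w} r rs) with simpleWalk rs
  ... | W with Fin.any? (λ i → seq W i Fin.≟ u)
  -- The vertex `u` is already on the walk, so everything before position `i` is cut off.
  ...   | yes (i , refl) = tailFrom W i
  ...   | no u∉W = record
    { len       = suc (len W)
    ; seq       = s
    ; injective = s-injective
    ; start     = refl
    ; end       = end W
    ; step      = λ { zero → subst (R u) (sym (start W)) r ; (suc i) → step W i }
    }
    where
    s : Fin (suc (suc (len W))) → Fin N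
    s zero    = u
    s (suc i) = seq W i
    s-injective : Injective _≡_ _≡_ s
    s-injective {zero}  {zero}  _  = refl
    s-injective {zero}  {suc j} eq = ⊥-elim (u∉W (j , sym eq))
    s-injective {suc i} {zero}  eq = ⊥-elim (u∉W (i , eq))
    s-injective {suc i} {suc j} eq = cong suc (injective W eq)

module _ {n} {P : Pred (Fin n) 0ℓ} (P? : Decidable P) where

  subsetOf : Subset n
  subsetOf = Vec.tabulate (does ∘ P?)

  ∈-subsetOf⁺ : ∀ {x} → P x → x ∈ subsetOf
  ∈-subsetOf⁺ {x} px = lookup⇒[]= x subsetOf (trans (lookup∘tabulate (does ∘ P?) x) (dec-true (P? x) px))

  ∈-subsetOf⁻ : ∀ {x} → x ∈ subsetOf → P x
  ∈-subsetOf⁻ {x} x∈ with P? x | trans (sym (lookup∘tabulate (does ∘ P?) x)) ([]=⇒lookup x∈)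
  ... | yes px | _  = px
  ... | no _   | ()

module _ {N} {R : Rel (Fin N) 0ℓ} {u v} (W : SimpleWalk R u v) where
  open SimpleWalk W

  private
    Consecutive : Fin N → Fin N → Set
    Consecutive x y = ∃[ i ] ((seq (inject₁ i) ≡ x × seq (suc i) ≡ y) ⊎
                              (seq (inject₁ i) ≡ y × seq (suc i) ≡ x))

    consecutive? : ∀ x → Decidable (Consecutive x)
    consecutive? x y = Fin.any? λ i → (seq (inject₁ i) Fin.≟ x ×-dec seq (suc i) Fin.≟ y) ⊎-dec
                                      (seq (inject₁ i) Fin.≟ y ×-dec seq (suc i) Fin.≟ x)

    visited? : Decidable (λ x → ∃[ i ] seq i ≡ x)
    visited? x = Fin.any? λ i → seq i Fin.≟ x

    inject₁≢suc : ∀ {n} (i : Fin n) → inject₁ i ≢ suc i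
    inject₁≢suc i eq = ℕ.1+n≢n (trans (sym (cong toℕ eq)) (Fin.toℕ-inject₁ i))

  -- `Separates` quantifies over subgraphs, so a walk has to be turned into one.
  walkGraph : Graph N
  walkGraph = record
    { V           = subsetOf visited?
    ; nbrs        = λ x → subsetOf (consecutive? x)
    ; nbrs⊆V      = λ {x} p → ∈-subsetOf⁺ visited? (visits (∈-subsetOf⁻ (consecutive? x) p))
    ; symmetric   = λ {x} {y} p → ∈-subsetOf⁺ (consecutive? y) (flip (∈-subsetOf⁻ (consecutive? x) p))
    ; irreflexive = λ {x} p → noLoop (∈-subsetOf⁻ (consecutive? x) p)
    }
    where
    visits : ∀ {x y} → Consecutive x y → ∃[ i ] seq i ≡ y
    visits (i , inj₁ (_ , eq)) = suc i , eq
    visits (i , inj₂ (eq , _)) = inject₁ i , eq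
    flip : ∀ {x y} → Consecutive x y → Consecutive y x
    flip (i , c) = i , Sum.swap c
    noLoop : ∀ {x} → ¬ Consecutive x x
    noLoop (i , inj₁ (p , q)) = inject₁≢suc i (injective (trans p (sym q)))
    noLoop (i , inj₂ (p , q)) = inject₁≢suc i (injective (trans p (sym q)))

  walkGraph-isPath : IsPath walkGraph u v
  walkGraph-isPath = record
    { len = len; seq = seq; injective = injective; start = start; end = end
    ; vertices = λ x → mk⇔ (∈-subsetOf⁻ visited?) (∈-subsetOf⁺ visited?)
    ; edges    = λ x y → mk⇔ (∈-subsetOf⁻ (consecutive? x)) (∈-subsetOf⁺ (consecutive? x))
    }

  walkGraph-⊑ : ∀ {G : Graph N} → u ∈ V G → (∀ {x y} → R x y → G ⊢ x ~ y) → walkGraph ⊑ G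
  walkGraph-⊑ {G} u∈G R⇒~ =
      (λ x∈ → let i , eq = ∈-subsetOf⁻ visited? x∈ in subst (_∈ V G) eq (visits-G i))
    , (λ {x} y∈ → adjacent (∈-subsetOf⁻ (consecutive? x) y∈))
    where
    visits-G : ∀ i → seq i ∈ V G
    visits-G zero    = subst (_∈ V G) (sym start) u∈G
    visits-G (suc i) = nbrs⊆V G (R⇒~ (step i))
    adjacent : ∀ {x y} → Consecutive x y → G ⊢ x ~ y
    adjacent (i , inj₁ (refl , refl)) = R⇒~ (step i)
    adjacent (i , inj₂ (refl , refl)) = symmetric G (R⇒~ (step i))

  walkGraph-vertices : ∀ {Q : Pred (Fin N) 0ℓ} → Q u → (∀ {x y} → R x y → Q y) →
                       ∀ {x} → x ∈ V walkGraph → Q x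
  walkGraph-vertices {Q} Qu R⇒Q x∈ with ∈-subsetOf⁻ visited? x∈
  ... | zero  , refl = subst Q (sym start) Qu
  ... | suc i , refl = R⇒Q (step i)

Star-isEquivalence : ∀ {A : Set} {R : Rel A 0ℓ} → (∀ {x y} → R x y → R y x) → IsEquivalence (Star R)
Star-isEquivalence R-sym = record { refl = ε ; sym = reverse R-sym ; trans = _◅◅_ }

Star-constant : ∀ {A B : Set} {R : Rel A 0ℓ} (f : A → B) → (∀ {x y} → R x y → f x ≡ f y) →
                ∀ {x y} → Star R x y → f x ≡ f y
Star-constant f const ε        = refl
Star-constant f const (r ◅ rs) = trans (const r) (Star-constant f const rs)

-- The two sides of a tree edge

module TreeSides {M} (T : Graph M) (isTree : IsTree T) where
  open IsTree isTree

  SameEdge : (s t x y : Fin M) → Set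
  SameEdge s t x y = (x ≡ s × y ≡ t) ⊎ (x ≡ t × y ≡ s)

  sameEdge? : ∀ s t x y → Dec (SameEdge s t x y)
  sameEdge? s t x y = (x Fin.≟ s ×-dec y Fin.≟ t) ⊎-dec (x Fin.≟ t ×-dec y Fin.≟ s)

  otherEdges : Fin M → Fin M → List (Fin M × Fin M)
  otherEdges s t = filter (λ (x , y) → ¬? (sameEdge? s t x y)) (darts T)

  private module U = UnionFind {E = Fin M × Fin M} proj₁ proj₂

  sideClass : Fin M → Fin M → Fin M → Fin M
  sideClass s t = U.class (otherEdges s t)

  -- Whether r lies in the component of s once the edge st is deleted.
  side : (s t r : Fin M) → Bool
  side s t r = does (sideClass s t r Fin.≟ sideClass s t s)

  side-self : ∀ s t → side s t s ≡ true
  side-self s t = dec-true (sideClass s t s Fin.≟ sideClass s t s) refl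

  side-other-edge : ∀ {s t x y} → T ⊢ x ~ y → ¬ SameEdge s t x y → side s t x ≡ side s t y
  side-other-edge {s} {t} x~y other = cong (λ c → does (c Fin.≟ sideClass s t s))
    (U.class-edge (otherEdges s t) (∈-filter⁺ _ (∈-darts⁺ T x~y) other))

  -- A connection from `s` to `t` that avoids the edge between them, once made simple, has length at
  -- least two and closes up to a cycle.
  side-opposite : ∀ {s t} → T ⊢ s ~ t → side s t t ≡ false
  side-opposite {s} {t} s~t = dec-false (sideClass s t t Fin.≟ sideClass s t s) λ eq → noCycle (simpleWalk
      (U.class-least (Star-isEquivalence R-sym) (otherEdges s t)
        (λ e∈ → let d∈ , other = ∈-filter⁻ (λ (x , y) → ¬? (sameEdge? s t x y)) {xs = darts T} e∈
                in (∈-darts⁻ T d∈ , other) ◅ ε)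
        (sym eq)))
    where
    R : Rel (Fin M) 0ℓ
    R x y = T ⊢ x ~ y × ¬ SameEdge s t x y
    R-sym : ∀ {x y} → R x y → R y x
    R-sym (x~y , other) = symmetric T x~y , λ same → other
      (Sum.swap (Sum.map swap swap same))
    noCycle : ¬ SimpleWalk R s t
    noCycle record { len = 0 ; start = refl ; end = refl } = irreflexive T s~t
    noCycle record { len = 1 ; start = start ; end = end ; step = step } =
      proj₂ (step zero) (inj₁ (start , end))
    noCycle record { len = suc (suc k) ; seq = seq ; injective = inj
                   ; start = refl ; end = refl ; step = step } =
      acyclic record { k = k ; seq = seq ; injective = inj ; step = proj₁ ∘ step ; close = symmetric T s~t }

  -- Exactly one summand is true at `s` and at `t`, and neither changes along any other edge of the
  -- connected tree.
  sides-complementary : ∀ {s t} → T ⊢ s ~ t → V T ≡ ⊤ → ∀ r → side s t r xor side t s r ≡ true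
  sides-complementary {s} {t} s~t spanning r = trans
    (Star-constant both constant (connected (subst (r ∈_) (sym spanning) ∈⊤) (nbrs⊆V T (symmetric T s~t))))
    at-s
    where
    both : Fin M → Bool
    both r = side s t r xor side t s r
    at-s : both s ≡ true
    at-s = cong₂ _xor_ (side-self s t) (side-opposite (symmetric T s~t))
    at-t : both t ≡ true
    at-t = cong₂ _xor_ (side-opposite s~t) (side-self t s)
    constant : ∀ {x y} → T ⊢ x ~ y → both x ≡ both y
    constant {x} {y} x~y with sameEdge? s t x y
    ... | yes (inj₁ (refl , refl)) = trans at-s (sym at-t)
    ... | yes (inj₂ (refl , refl)) = trans at-t (sym at-s)
    ... | no other = cong₂ _xor_ (side-other-edge x~y other) (side-other-edge x~y (other ∘ Sum.swap))

-- Nonzero sums and lengths of filtered lists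

⨁-true⇒∃ : ∀ {A : Set} (xs : List A) {f} → ⨁ xs f ≡ true → ∃[ x ] (x ∈ˡ xs × f x ≡ true)
⨁-true⇒∃ (x ∷ xs) {f} eq with f x in fx
... | true  = x , here refl , fx
... | false with ⨁-true⇒∃ xs eq
...   | y , y∈ , fy = y , there y∈ , fy

module _ {A : Set} {P Q : Pred A 0ℓ} (P? : Decidable P) (Q? : Decidable Q) where

  length-filter-≤ : ∀ xs → (∀ {x} → x ∈ˡ xs → P x → Q x) → length (filter P? xs) ≤ length (filter Q? xs)
  length-filter-≤ []       P⇒Q = z≤n
  length-filter-≤ (x ∷ xs) P⇒Q with P? x | Q? x
  ... | yes p | yes _ = s≤s (length-filter-≤ xs (P⇒Q ∘ there))
  ... | yes p | no ¬q = ⊥-elim (¬q (P⇒Q (here refl) p))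
  ... | no _  | yes _ = ℕ.m≤n⇒m≤1+n (length-filter-≤ xs (P⇒Q ∘ there))
  ... | no _  | no _  = length-filter-≤ xs (P⇒Q ∘ there)

  length-filter-< : ∀ xs → (∀ {x} → x ∈ˡ xs → P x → Q x) → ∀ {x} → x ∈ˡ xs → ¬ P x → Q x →
                    length (filter P? xs) < length (filter Q? xs)
  length-filter-< (x ∷ xs) P⇒Q (here refl) ¬p q with P? x | Q? x
  ... | yes p | _     = ⊥-elim (¬p p)
  ... | no _  | no ¬q = ⊥-elim (¬q q)
  ... | no _  | yes _ = s≤s (length-filter-≤ xs (P⇒Q ∘ there))
  length-filter-< (x ∷ xs) P⇒Q (there x∈) ¬p q with P? x | Q? x
  ... | yes p | yes _ = s≤s (length-filter-< xs (P⇒Q ∘ there) x∈ ¬p q)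
  ... | yes p | no ¬q = ⊥-elim (¬q (P⇒Q (here refl) p))
  ... | no _  | yes _ = ℕ.m<n⇒m<1+n (length-filter-< xs (P⇒Q ∘ there) x∈ ¬p q)
  ... | no _  | no _  = length-filter-< xs (P⇒Q ∘ there) x∈ ¬p q

∉-difference : ∀ {m} (p q : Subset m) {x} → x ∈ p ─ q → x ∉ q
∉-difference (_ ∷ p) (outside ∷ q) (there x∈) (there x∈q) = ∉-difference p q x∈ x∈q
∉-difference (_ ∷ p) (inside  ∷ q) (there x∈) (there x∈q) = ∉-difference p q x∈ x∈q

-- Slabs

Avoids : ∀ {N} → Graph N → Subset N → Set
Avoids H β = Empty (V H ∩ β)

-- Pigeonhole: elements of `β` picked from disjoint graphs are distinct, so `β` cannot meet all `n`
-- of them.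
some-avoids : ∀ {N n} (H : Fin n → Graph N) → (∀ {i j} → i ≢ j → VertexDisjoint (H i) (H j)) →
              ∀ β → ∣ β ∣ < n → ∃[ i ] Avoids (H i) β
some-avoids {n = n} H disjoint β ∣β∣<n =
  Fin.¬∀⟶∃¬ n (λ i → Nonempty (V (H i) ∩ β)) (λ i → nonempty? (V (H i) ∩ β)) λ hit →
    ℕ.<⇒≱ ∣β∣<n (subst (n ≤_) (length-elements β) (Fin.injective⇒≤ (position-injective hit)))
  where
  module _ (hit : ∀ i → Nonempty (V (H i) ∩ β)) where
    ∈β : ∀ i → proj₁ (hit i) ∈ˡ elements β
    ∈β i = ∈-elements β (proj₂ (x∈p∩q⁻ (V (H i)) β (proj₂ (hit i))))

    position-injective : ∀ {i j} → index (∈β i) ≡ index (∈β j) → i ≡ j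
    position-injective {i} {j} eq with i Fin.≟ j
    ... | yes i≡j = i≡j
    ... | no  i≢j = ⊥-elim (disjoint i≢j (proj₁ (hit i) , x∈p∩q⁺
            ( proj₁ (x∈p∩q⁻ (V (H i)) β (proj₂ (hit i)))
            , subst (_∈ V (H j)) (sym (index-injective (setoid _) (∈β i) (∈β j) eq))
                (proj₁ (x∈p∩q⁻ (V (H j)) β (proj₂ (hit j)))))))

-- Sums along paths

module _ {N : ℕ} where

  steps : ∀ len → (Fin (suc len) → Fin N) → List (Fin N × Fin N)
  steps len seq = tabulate λ k → seq (inject₁ k) , seq (suc k)

  telescope : ∀ len seq (φ : Fin N → Bool) →
              ⨁ (steps len seq) (λ (u , v) → φ u xor φ v) ≡ φ (seq zero) xor φ (seq (fromℕ len))
  telescope zero      seq φ = sym (xor-same (φ (seq zero)))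
  telescope (suc len) seq φ = trans
      (cong ((φ (seq zero) xor φ (seq (suc zero))) xor_) (telescope len (seq ∘ suc) φ))
      (cancel (φ (seq zero)) (φ (seq (suc zero))) _)
    where
    cancel : ∀ a b c → (a xor b) xor (b xor c) ≡ a xor c
    cancel a b c = trans (xor-assoc a b (b xor c)) (cong (a xor_)
      (trans (sym (xor-assoc b b c)) (cong (_xor c) (xor-same b))))

  module _ {P : Graph N} {a b} (p : IsPath P a b) where
    open IsPath p

    pathSteps : List (Fin N × Fin N)
    pathSteps = steps len seq

    ∈-pathSteps : ∀ {u v} → (u , v) ∈ˡ pathSteps → P ⊢ u ~ v
    ∈-pathSteps e∈ with ∈-tabulate⁻ e∈
    ... | k , refl = Equivalence.from (edges _ _) (k , inj₁ (refl , refl))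

    path-telescope : ∀ φ → ⨁ pathSteps (λ (u , v) → φ u xor φ v) ≡ φ a xor φ b
    path-telescope φ = trans (telescope len seq φ) (cong₂ (λ x y → φ x xor φ y) start end)

    start∈ : a ∈ V P
    start∈ = Equivalence.from (vertices a) (zero , start)

    end∈ : b ∈ V P
    end∈ = Equivalence.from (vertices b) (fromℕ len , end)

    path-constant : ∀ (φ : Fin N → Bool) → (∀ {u v} → P ⊢ u ~ v → φ u ≡ φ v) →
                    ∀ {x y} → x ∈ V P → y ∈ V P → φ x ≡ φ y
    path-constant φ const x∈ y∈ = trans (to-start x∈) (sym (to-start y∈))
      where
      along : ∀ n (s : Fin (suc n) → Fin N) → (∀ i → φ (s (inject₁ i)) ≡ φ (s (suc i))) →
              ∀ i → φ (s i) ≡ φ (s zero)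
      along n       s c zero    = refl
      along (suc n) s c (suc i) = trans (along n (s ∘ suc) (c ∘ suc) i) (sym (c zero))
      to-start : ∀ {x} → x ∈ V P → φ x ≡ φ (seq zero)
      to-start x∈ with Equivalence.to (vertices _) x∈
      ... | i , refl = along len seq (λ k → const (Equivalence.from (edges _ _) (k , inj₁ (refl , refl)))) i

-- Contacts between a region and a part of its barrier

module Barrier {N} {G S₁ S₂ : Graph N} (X : Subset N) (U : Fin N → Bool)
  (U-barrier : ∀ {x} → x ∈ X → U x ≡ false)
  (U-closed  : ∀ {u v} → G ⊢ u ~ v → u ∉ X → v ∉ X → U u ≡ U v)
  (S₁∌X : ∀ {x} → x ∈ V S₁ → x ∉ X) (S₂∌X : ∀ {x} → x ∈ V S₂ → x ∉ X)  where

  -- For disjoint `U` and `Y` this marks the edges between them. Using `xor` makes it additive in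
  -- `Y`.
  contact : (Fin N → Bool) → Fin N → Fin N → Bool
  contact Y u v = (U u ∧ Y v) xor (Y u ∧ U v)

  contact-sym : ∀ Y u v → contact Y u v ≡ contact Y v u
  contact-sym Y u v = trans (xor-comm (U u ∧ Y v) (Y u ∧ U v))
                            (cong₂ _xor_ (∧-comm (Y u) (U v)) (∧-comm (U u) (Y v)))

  contact-⨁ : ∀ {A : Set} (xs : List A) (Y : A → Fin N → Bool) u v →
              ⨁ xs (λ s → contact (Y s) u v) ≡ contact (λ x → ⨁ xs (λ s → Y s x)) u v
  contact-⨁ xs Y u v = trans (⨁-xor xs _ _) (cong₂ _xor_ (⨁-∧ˡ xs (U u) (λ s → Y s v))
    (trans (⨁-cong xs (λ {s} _ → ∧-comm (Y s u) (U v)))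
      (trans (⨁-∧ˡ xs (U v) (λ s → Y s u)) (∧-comm (U v) _))))

  contact-cong : ∀ {Y Y′ u v} → Y u ≡ Y′ u → Y v ≡ Y′ v → contact Y u v ≡ contact Y′ u v
  contact-cong {u = u} {v} p q = cong₂ (λ a b → (U u ∧ b) xor (a ∧ U v)) p q

  -- `U` is disjoint from `X` and closed under adjacency outside `X`, so an edge with just one end
  -- in `U` has the other end in `X`.
  contact-X : ∀ {u v} → G ⊢ u ~ v → contact (λ x → does (x ∈? X)) u v ≡ U u xor U v
  contact-X {u} {v} u~v with u ∈? X | v ∈? X
  ... | yes u∈ | yes v∈ rewrite U-barrier u∈ | U-barrier v∈ = refl
  ... | yes u∈ | no  _  rewrite U-barrier u∈ = refl
  ... | no  _  | yes v∈ rewrite U-barrier v∈ | ∧-identityʳ (U u) = refl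
  ... | no  u∉ | no  v∉ rewrite U-closed u~v u∉ v∉ | ∧-zeroʳ (U v) = sym (xor-same (U v))

  module _ {H : Graph N} (H⊑G : H ⊑ G) (T : NearTriangulation H) (Y : Fin N → Bool)
    (Y⊆X : ∀ {x} → x ∉ X → Y x ≡ false)
    (Y-closed : ∀ {u v} → H ⊢ u ~ v → u ∈ X → v ∈ X → Y u ≡ Y v)
    where

    -- Cases by the number of vertices in `X`. If there are two, `Y` agrees on them, so the third is
    -- in contact with both or neither. If there is one, `U` agrees on the other two. Otherwise
    -- there are no contacts.
    contact-even : EvenOnTriangles H (contact Y)
    contact-even {u} {v} {w} u~v v~w w~u = by-cases (u ∈? X) (v ∈? X) (w ∈? X)
      where
      inside₂ : ∀ y c → ((false ∧ y) xor (y ∧ false)) xor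
                        (((false ∧ false) xor (y ∧ c)) xor ((c ∧ y) xor (false ∧ false))) ≡ false
      inside₂ true  true  = refl
      inside₂ true  false = refl
      inside₂ false true  = refl
      inside₂ false false = refl
      inside₁ : ∀ y c → ((false ∧ false) xor (y ∧ c)) xor
                        (((c ∧ false) xor (false ∧ c)) xor ((c ∧ y) xor (false ∧ false))) ≡ false
      inside₁ true  true  = refl
      inside₁ true  false = refl
      inside₁ false true  = refl
      inside₁ false false = refl

      turn : ∀ u v w → contact Y v w xor (contact Y w u xor contact Y u v) ≡ false →
             contact Y u v xor (contact Y v w xor contact Y w u) ≡ false
      turn u v w eq = trans (xor-comm (contact Y u v) _)
                        (trans (xor-assoc (contact Y v w) (contact Y w u) (contact Y u v)) eq)

      two : ∀ {u v w} → H ⊢ u ~ v → u ∈ X → v ∈ X → w ∉ X →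
            contact Y u v xor (contact Y v w xor contact Y w u) ≡ false
      two {u} {v} {w} u~v u∈ v∈ w∉
        rewrite U-barrier u∈ | U-barrier v∈ | Y⊆X w∉ | Y-closed u~v u∈ v∈ = inside₂ (Y v) (U w)

      one : ∀ {u v w} → H ⊢ v ~ w → u ∈ X → v ∉ X → w ∉ X →
            contact Y u v xor (contact Y v w xor contact Y w u) ≡ false
      one {u} {v} {w} v~w u∈ v∉ w∉
        rewrite U-barrier u∈ | Y⊆X v∉ | Y⊆X w∉ | U-closed (proj₂ H⊑G v~w) v∉ w∉ = inside₁ (Y u) (U w)

      by-cases : Dec (u ∈ X) → Dec (v ∈ X) → Dec (w ∈ X) →
                 contact Y u v xor (contact Y v w xor contact Y w u) ≡ false
      by-cases (yes u∈) (yes v∈) (yes w∈)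
        rewrite U-barrier u∈ | U-barrier v∈ | U-barrier w∈
              | ∧-zeroʳ (Y u) | ∧-zeroʳ (Y v) | ∧-zeroʳ (Y w) = refl
      by-cases (yes u∈) (yes v∈) (no  w∉) = two u~v u∈ v∈ w∉
      by-cases (no  u∉) (yes v∈) (yes w∈) = turn u v w (two v~w v∈ w∈ u∉)
      by-cases (yes u∈) (no  v∉) (yes w∈) = turn u v w (turn v w u (two w~u w∈ u∈ v∉))
      by-cases (yes u∈) (no  v∉) (no  w∉) = one v~w u∈ v∉ w∉
      by-cases (no  u∉) (yes v∈) (no  w∉) = turn u v w (one w~u v∈ w∉ u∉)
      by-cases (no  u∉) (no  v∉) (yes w∈) = turn u v w (turn v w u (one u~v w∈ u∉ v∉))
      by-cases (no  u∉) (no  v∉) (no  w∉)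
        rewrite Y⊆X u∉ | Y⊆X v∉ | Y⊆X w∉ | ∧-zeroʳ (U u) | ∧-zeroʳ (U v) | ∧-zeroʳ (U w) = refl

    -- By `exact`, the contacts along a path sum to the difference of a potential `φ` at its ends.
    -- `H` meets each of `S₁` and `S₂` in a path, which has no contacts because it avoids `X`. So
    -- `φ` is constant there, and the ends may move along it.
    contacts-independent : MeetsInOuterPath T S₁ → MeetsInOuterPath T S₂ →
      ∀ {P P′ a b a′ b′} (p : IsPath P a b) (p′ : IsPath P′ a′ b′) → P ⊑ H → P′ ⊑ H →
      a ∈ V S₁ → a′ ∈ V S₁ → b ∈ V S₂ → b′ ∈ V S₂ →
      ⨁ (pathSteps p) (uncurry (contact Y)) ≡ ⨁ (pathSteps p′) (uncurry (contact Y))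
    contacts-independent ((_ , _ , q₁) , _) ((_ , _ , q₂) , _) p p′ P⊑H P′⊑H a∈ a′∈ b∈ b′∈ =
      uncurry given (exact T {contact Y} (contact-sym Y) contact-even)
      where
      given : ∀ φ → (∀ {u v} → H ⊢ u ~ v → contact Y u v ≡ φ u xor φ v) →
              ⨁ (pathSteps p) (uncurry (contact Y)) ≡ ⨁ (pathSteps p′) (uncurry (contact Y))
      given φ θ≡δφ = trans (contacts p P⊑H) (trans (cong₂ _xor_
            (on-side S₁ q₁ S₁∌X (start-in S₁ p P⊑H a∈) (start-in S₁ p′ P′⊑H a′∈))
            (on-side S₂ q₂ S₂∌X (end-in S₂ p P⊑H b∈) (end-in S₂ p′ P′⊑H b′∈))) (sym (contacts p′ P′⊑H)))
        where
        contacts : ∀ {P a b} (p : IsPath P a b) → P ⊑ H → ⨁ (pathSteps p) (uncurry (contact Y)) ≡ φ a xor φ b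
        contacts p P⊑H = trans (⨁-cong (pathSteps p) (λ e∈ → θ≡δφ (proj₂ P⊑H (∈-pathSteps p e∈))))
                               (path-telescope p φ)
        start-in : ∀ S {P a b} (p : IsPath P a b) → P ⊑ H → a ∈ V S → a ∈ V (H ⊓ S)
        start-in S p P⊑H a∈ = x∈p∩q⁺ (proj₁ P⊑H (start∈ p) , a∈)
        end-in : ∀ S {P a b} (p : IsPath P a b) → P ⊑ H → b ∈ V S → b ∈ V (H ⊓ S)
        end-in S p P⊑H b∈ = x∈p∩q⁺ (proj₁ P⊑H (end∈ p) , b∈)
        on-side : ∀ S {x y c d} → IsPath (H ⊓ S) c d → (∀ {x} → x ∈ V S → x ∉ X) →
                  x ∈ V (H ⊓ S) → y ∈ V (H ⊓ S) → φ x ≡ φ y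
        on-side S q S∌X = path-constant q φ λ {u} {v} u~v →
          let u~v∈H , u~v∈S = x∈p∩q⁻ (nbrs H u) (nbrs S u) u~v
              v∈S = nbrs⊆V S u~v∈S
              u∈S = nbrs⊆V S (symmetric S u~v∈S)
          in xor-false (trans (sym (θ≡δφ u~v∈H)) (no-contact (Y⊆X (S∌X u∈S)) (Y⊆X (S∌X v∈S))))
          where
          no-contact : ∀ {u v} → Y u ≡ false → Y v ≡ false → contact Y u v ≡ false
          no-contact {u} p q rewrite p | q | ∧-zeroʳ (U u) = refl

-- Parities of the crossings

module _ {N} {n} {G S₁ S₂ : Graph N} (1≤n : 1 ≤ n) (slab : Slab n G S₁ S₂)
  (X : Subset N) (X⊆ : X ⊆ V G ─ (V S₁ ∪ V S₂)) (separates : Separates G S₁ S₂ X) where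
  open Slab slab

  X⊆G : X ⊆ V G
  X⊆G = p─q⊆p (V G) (V S₁ ∪ V S₂) ∘ X⊆

  S₁∌X : ∀ {x} → x ∈ V S₁ → x ∉ X
  S₁∌X x∈S x∈X = ∉-difference (V G) (V S₁ ∪ V S₂) (X⊆ x∈X) (x∈p∪q⁺ (inj₁ x∈S))

  S₂∌X : ∀ {x} → x ∈ V S₂ → x ∉ X
  S₂∌X x∈S x∈X = ∉-difference (V G) (V S₁ ∪ V S₂) (X⊆ x∈X) (x∈p∪q⁺ (inj₂ x∈S))

  -- A vertex of `S₁`: by `1 ≤ n` there is a crossing to take it from.
  base : Fin N
  base = proj₁ (crossing (fromℕ< 1≤n) (fromℕ< 1≤n))

  base∈S₁ : base ∈ V S₁
  base∈S₁ = proj₁ (proj₂ (proj₂ (proj₂ (crossing (fromℕ< 1≤n) (fromℕ< 1≤n)))))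

  Free : Rel (Fin N) 0ℓ
  Free u v = G ⊢ u ~ v × u ∉ X × v ∉ X

  Free-sym : ∀ {u v} → Free u v → Free v u
  Free-sym (u~v , u∉ , v∉) = symmetric G u~v , v∉ , u∉

  free? : Decidable (uncurry Free)
  free? (u , v) = (v ∈? nbrs G u) ×-dec (¬? (u ∈? X) ×-dec ¬? (v ∈? X))

  private module F = UnionFind {E = Fin N × Fin N} proj₁ proj₂

  freeEdges : List (Fin N × Fin N)
  freeEdges = filter free? (darts G)

  region : Fin N → Fin N
  region = F.class freeEdges

  region-free : ∀ {u v} → Free u v → region u ≡ region v
  region-free f = F.class-edge freeEdges (∈-filter⁺ free? (∈-darts⁺ G (proj₁ f)) f)

  region-linked : ∀ {u v} → region u ≡ region v → Star Free u v
  region-linked = F.class-least (Star-isEquivalence Free-sym) freeEdges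
    (λ e∈ → proj₂ (∈-filter⁻ free? {xs = darts G} e∈) ◅ ε)

  -- The set U, with `base` standing for all of the connected `S₁`. Union-find on the free edges
  -- makes it decidable.
  below? : Decidable (λ x → x ∉ X × region x ≡ region base)
  below? x = ¬? (x ∈? X) ×-dec (region x Fin.≟ region base)

  below : Fin N → Bool
  below x = does (below? x)

  below-barrier : ∀ {x} → x ∈ X → below x ≡ false
  below-barrier {x} x∈ = dec-false (below? x) λ (x∉ , _) → x∉ x∈

  below-closed : ∀ {u v} → G ⊢ u ~ v → u ∉ X → v ∉ X → below u ≡ below v
  below-closed {u} {v} u~v u∉ v∉ = does-⇔ (mk⇔
      (λ (_ , eq) → v∉ , trans (sym same) eq) (λ (_ , eq) → u∉ , trans same eq)) (below? u) (below? v)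
    where
    same : region u ≡ region v
    same = region-free (u~v , u∉ , v∉)

  below-S₁ : ∀ {x} → x ∈ V S₁ → below x ≡ true
  below-S₁ {x} x∈ = dec-true (below? x) (S₁∌X x∈ , Star-constant region
    (λ u~v → region-free ( proj₂ S₁⊑G u~v , S₁∌X (nbrs⊆V S₁ (symmetric S₁ u~v)) , S₁∌X (nbrs⊆V S₁ u~v)))
    (S₁-connected x∈ base∈S₁))

  -- A connection outside `X`, once made simple, would be a path that `separates` forbids.
  below-S₂ : ∀ {x} → x ∈ V S₂ → below x ≡ false
  below-S₂ {x} x∈ = dec-false (below? x) λ (_ , eq) → crosses (simpleWalk (region-linked (sym eq)))
    where
    crosses : ¬ SimpleWalk Free base x
    crosses W = let y , y∈ = separates (walkGraph W) (walkGraph-⊑ W {G} (proj₁ S₁⊑G base∈S₁) proj₁)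
                               (walkGraph-isPath W) base∈S₁ x∈
                    y∈W , y∈X = x∈p∩q⁻ (V (walkGraph W)) X y∈
                in walkGraph-vertices W (S₁∌X base∈S₁) (proj₂ ∘ proj₂) y∈W y∈X

  open Barrier {G = G} {S₁ = S₁} {S₂ = S₂} X below
    below-barrier below-closed S₁∌X S₂∌X

  crossingPath : ∀ i j → IsPath (row i ⊓ col j) (proj₁ (crossing i j)) (proj₁ (proj₂ (crossing i j)))
  crossingPath i j = proj₁ (proj₂ (proj₂ (crossing i j)))

  crossing-start : ∀ i j → proj₁ (crossing i j) ∈ V S₁
  crossing-start i j = proj₁ (proj₂ (proj₂ (proj₂ (crossing i j))))

  crossing-end : ∀ i j → proj₁ (proj₂ (crossing i j)) ∈ V S₂
  crossing-end i j = proj₂ (proj₂ (proj₂ (proj₂ (crossing i j))))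

  crossing⊑row : ∀ i j → row i ⊓ col j ⊑ row i
  crossing⊑row i j = p∩q⊆p (V (row i)) (V (col j)) , λ {u} → p∩q⊆p (nbrs (row i) u) (nbrs (col j) u)

  crossing⊑col : ∀ i j → row i ⊓ col j ⊑ col j
  crossing⊑col i j = p∩q⊆q (V (row i)) (V (col j)) , λ {u} → p∩q⊆q (nbrs (row i) u) (nbrs (col j) u)

  parity : (Fin N → Bool) → Fin n → Fin n → Bool
  parity Y i j = ⨁ (pathSteps (crossingPath i j)) (uncurry (contact Y))

  -- Contacts are additive in `Y`. The sum is prescribed only on the row, which contains the
  -- crossing; this leaves room for exceptions on a bag that the row avoids.
  parity-⨁ : ∀ {A : Set} (xs : List A) (Y : A → Fin N → Bool) Z i j →
             (∀ {x} → x ∈ V (row i) → ⨁ xs (λ s → Y s x) ≡ Z x) →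
             ⨁ xs (λ s → parity (Y s) i j) ≡ parity Z i j
  parity-⨁ xs Y Z i j sums = trans (⨁-swap xs (pathSteps p) (λ s → uncurry (contact (Y s))))
      (⨁-cong (pathSteps p) λ {(u , v)} e∈ →
        let u~v = proj₂ (crossing⊑row i j) (∈-pathSteps p e∈) in
        trans (contact-⨁ xs Y u v) (contact-cong {λ x → ⨁ xs (λ s → Y s x)} {Z}
          (sums (nbrs⊆V (row i) (symmetric (row i) u~v))) (sums (nbrs⊆V (row i) u~v))))
    where p = crossingPath i j

  inX : Fin N → Bool
  inX x = does (x ∈? X)

  -- By `contact-X` the sum telescopes, and a crossing starts in `below` and ends outside it.
  parity-X : ∀ i j → parity inX i j ≡ true
  parity-X i j = trans (⨁-cong (pathSteps p) (λ e∈ →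
      contact-X (proj₂ (row⊑G i) (proj₂ (crossing⊑row i j) (∈-pathSteps p e∈)))))
    (trans (path-telescope p below)
      (cong₂ _xor_ (below-S₁ (crossing-start i j)) (below-S₂ (crossing-end i j))))
    where p = crossingPath i j

  module _ (Y : Fin N → Bool) (Y⊆X : ∀ {x} → x ∉ X → Y x ≡ false) (β : Subset N)
    (Y-closed : ∀ {u v} → G ⊢ u ~ v → u ∈ X → v ∈ X → u ∉ β → v ∉ β → Y u ≡ Y v) where

    closed-in : ∀ {H} → H ⊑ G → Avoids H β → ∀ {u v} → H ⊢ u ~ v → u ∈ X → v ∈ X → Y u ≡ Y v
    closed-in {H} (_ , nbrs⊆) avoids u~v u∈ v∈ = Y-closed (nbrs⊆ u~v) u∈ v∈
      (λ u∈β → avoids (_ , x∈p∩q⁺ (nbrs⊆V H (symmetric H u~v) , u∈β)))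
      (λ v∈β → avoids (_ , x∈p∩q⁺ (nbrs⊆V H u~v , v∈β)))

    parity-row : ∀ i j j′ → Avoids (row i) β → parity Y i j ≡ parity Y i j′
    parity-row i j j′ avoids =
      contacts-independent (row⊑G i) (row-nearTri i) Y Y⊆X (closed-in {row i} (row⊑G i) avoids)
        (row-S₁ i) (row-S₂ i) (crossingPath i j) (crossingPath i j′) (crossing⊑row i j) (crossing⊑row i j′)
        (crossing-start i j) (crossing-start i j′) (crossing-end i j) (crossing-end i j′)

    parity-col : ∀ i i′ j → Avoids (col j) β → parity Y i j ≡ parity Y i′ j
    parity-col i i′ j avoids =
      contacts-independent (col⊑G j) (col-nearTri j) Y Y⊆X (closed-in {col j} (col⊑G j) avoids)
        (col-S₁ j) (col-S₂ j) (crossingPath i j) (crossingPath i′ j) (crossing⊑col i j) (crossing⊑col i′ j)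
        (crossing-start i j) (crossing-start i′ j) (crossing-end i j) (crossing-end i′ j)

    -- One moves along row `i` to column `j′`, then along this column to row `i′`.
    parity-unique : ∀ {i j i′ j′} → Avoids (row i) β → Avoids (col j′) β → parity Y i j ≡ parity Y i′ j′
    parity-unique {i} {j} {i′} {j′} row-i col-j′ = trans (parity-row i j j′ row-i) (parity-col i i′ j′ col-j′)

  induced-adjacent : ∀ {u v} → u ∈ X → v ∈ X → G ⊢ u ~ v → induced G X ⊢ u ~ v
  induced-adjacent {u} u∈ v∈ u~v with u ∈? X
  ... | yes _  = x∈p∩q⁺ (u~v , v∈)
  ... | no  u∉ = ⊥-elim (u∉ u∈)

  -- The halves of X at the edges of a decomposition tree

  module _ (D : TreeDecomposition (induced G X)) where
    open TreeDecomposition D hiding (maxBag; width)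
    open TreeSides tree isTree

    node : Fin N → Fin M
    node x with x ∈? V (induced G X)
    ... | yes x∈ = proj₁ (vertexCovered x∈)
    -- A default value outside G[X]; `half` masks it by `inX`.
    ... | no  _  = proj₁ (IsTree.nonempty isTree)

    ∈-bag-node : ∀ {x} → x ∈ X → x ∈ bag (node x)
    ∈-bag-node {x} x∈ with x ∈? V (induced G X)
    ... | yes x∈′ = proj₂ (vertexCovered x∈′)
    ... | no  x∉  = ⊥-elim (x∉ (x∈p∩q⁺ (X⊆G x∈ , x∈)))

    -- The nodes whose bags contain `x` are connected, and the connection uses the edge between `s`
    -- and `t` only if both their bags contain `x`.
    side-bag : ∀ {s t x p q} → x ∉ bag s ∩ bag t → x ∈ bag p → x ∈ bag q → side s t p ≡ side s t q
    side-bag {s} {t} x∉ x∈p x∈q = Star-constant (side s t) (λ (p~q , x∈p , x∈q) → side-other-edge p~q λ where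
      (inj₁ (refl , refl)) → x∉ (x∈p∩q⁺ (x∈p , x∈q))
      (inj₂ (refl , refl)) → x∉ (x∈p∩q⁺ (x∈q , x∈p))) (coherent x∈p x∈q)

    -- The chosen `node` decides even for vertices in both bags of an edge, so its two halves always
    -- partition `X`.
    half : Fin M → Fin M → Fin N → Bool
    half s t x = inX x ∧ side s t (node x)

    half⊆X : ∀ s t {x} → x ∉ X → half s t x ≡ false
    half⊆X s t {x} x∉ = cong (_∧ side s t (node x)) (dec-false (x ∈? X) x∉)

    -- A node whose bag contains both ends lies on the same side as either chosen node.
    half-closed : ∀ s t {u v} → G ⊢ u ~ v → u ∈ X → v ∈ X → u ∉ bag s ∩ bag t → v ∉ bag s ∩ bag t →
                  half s t u ≡ half s t v
    half-closed s t {u} {v} u~v u∈ v∈ u∉ v∉ =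
      let r , u∈r , v∈r = edgeCovered (induced-adjacent u∈ v∈ u~v) in
      cong₂ _∧_ (trans (dec-true (u ∈? X) u∈) (sym (dec-true (v ∈? X) v∈)))
        (trans (side-bag u∉ (∈-bag-node u∈) u∈r) (side-bag v∉ v∈r (∈-bag-node v∈)))

    neighbours : Fin M → List (Fin M)
    neighbours t = filter (λ s → s ∈? nbrs tree t) (allFin M)

    ∈-neighbours⁻ : ∀ {s t} → s ∈ˡ neighbours t → tree ⊢ t ~ s
    ∈-neighbours⁻ {t = t} = proj₂ ∘ ∈-filter⁻ (λ s → s ∈? nbrs tree t) {xs = allFin M}

    branches : Fin M → Fin M → Bool
    branches t r = ⨁ (neighbours t) λ s → side s t r

    branches-self : ∀ t → branches t t ≡ false
    branches-self t = ⨁-false (neighbours t) λ s∈ → side-opposite (symmetric tree (∈-neighbours⁻ s∈))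

    -- For `s` other than `r`, the edge between `t` and `r` survives the deletion and keeps `r` on
    -- the side of `t`; only `s` equal to `r` counts.
    branches-neighbour : ∀ {t r} → tree ⊢ t ~ r → branches t r ≡ true
    branches-neighbour {t} {r} t~r = trans (⨁-cong (neighbours t) only-r)
        (trans (⨁-filter (λ s → s ∈? nbrs tree t) (allFin M) (λ s → does (r Fin.≟ s)))
        (trans (⨁-cong (allFin M) (λ {s} _ → ∧-comm (does (s ∈? nbrs tree t)) (does (r Fin.≟ s))))
        (trans (⨁-allFin-δ r (λ s → does (s ∈? nbrs tree t))) (dec-true (r ∈? nbrs tree t) t~r))))
      where
      only-r : ∀ {s} → s ∈ˡ neighbours t → side s t r ≡ does (r Fin.≟ s)
      only-r {s} s∈ with r Fin.≟ s
      ... | yes refl = side-self r t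
      ... | no  r≢s  = trans (sym (side-other-edge t~r λ where
              (inj₁ (refl , _)) → irreflexive tree (∈-neighbours⁻ s∈)
              (inj₂ (_ , r≡s))  → r≢s r≡s))
            (side-opposite (symmetric tree (∈-neighbours⁻ s∈)))

    -- Adding the indicator of `t` makes the sum constant along the edges at `t` too; along an edge
    -- that misses `t` no summand changes.
    branches-other : ∀ {t r} → r ≢ t → branches t r ≡ true
    branches-other {t} {r} r≢t = begin
        branches t r                          ≡⟨ xor-identityʳ _ ⟨
        branches t r xor false                ≡⟨ cong (branches t r xor_) (dec-false (r Fin.≟ t) r≢t) ⟨
        branches t r xor does (r Fin.≟ t)
          ≡⟨ Star-constant total constant (IsTree.connected isTree (∈V r) (∈V t)) ⟩
        branches t t xor does (t Fin.≟ t)     ≡⟨ cong₂ _xor_ (branches-self t) (dec-true (t Fin.≟ t) refl) ⟩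
        true ∎
      where
      open ≡-Reasoning
      ∈V : ∀ s → s ∈ V tree
      ∈V s = subst (s ∈_) (sym spanning) ∈⊤
      total : Fin M → Bool
      total r = branches t r xor does (r Fin.≟ t)
      total-self : total t ≡ true
      total-self = cong₂ _xor_ (branches-self t) (dec-true (t Fin.≟ t) refl)
      total-neighbour : ∀ {r} → tree ⊢ t ~ r → total r ≡ true
      total-neighbour {r} t~r = cong₂ _xor_ (branches-neighbour t~r)
        (dec-false (r Fin.≟ t) λ { refl → irreflexive tree t~r })
      constant : ∀ {x y} → tree ⊢ x ~ y → total x ≡ total y
      constant {x} {y} x~y = by-cases (x Fin.≟ t) (y Fin.≟ t)
        where
        by-cases : Dec (x ≡ t) → Dec (y ≡ t) → total x ≡ total y
        by-cases (yes refl) _          = trans total-self (sym (total-neighbour x~y))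
        by-cases (no _)     (yes refl) = trans (total-neighbour (symmetric tree x~y)) (sym total-self)
        by-cases (no x≢t)   (no y≢t)   = cong₂ _xor_
          (⨁-cong (neighbours t) λ _ → side-other-edge x~y λ where
            (inj₁ (_ , y≡t)) → y≢t y≡t
            (inj₂ (x≡t , _)) → x≢t x≡t)
          (trans (dec-false (x Fin.≟ t) x≢t) (sym (dec-false (y Fin.≟ t) y≢t)))

    -- Orienting the tree when all bags are small

    module _ (small : maxBag D < n) where

      bag-small : ∀ t → ∣ bag t ∣ < n
      bag-small t = ℕ.≤-<-trans (All.lookup (xs≤max 0 (tabulate λ t → ∣ bag t ∣))
                                  (∈-tabulate⁺ {f = λ t → ∣ bag t ∣} t)) small

      freeRow freeCol : Fin M → Fin n
      freeRow t = proj₁ (some-avoids row row-disjoint (bag t) (bag-small t))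
      freeCol t = proj₁ (some-avoids col col-disjoint (bag t) (bag-small t))

      freeRow-avoids : ∀ t → Avoids (row (freeRow t)) (bag t)
      freeRow-avoids t = proj₂ (some-avoids row row-disjoint (bag t) (bag-small t))

      freeCol-avoids : ∀ t → Avoids (col (freeCol t)) (bag t)
      freeCol-avoids t = proj₂ (some-avoids col col-disjoint (bag t) (bag-small t))

      -- The orientation of the edge ts: whether it points from t to s.
      points : Fin M → Fin M → Bool
      points t s = parity (half s t) (freeRow t) (freeCol t)

      -- On a row that avoids `bag t`, the halves belonging to the neighbours of `t` add up to `X`.
      -- Its parity is odd, so that of some half is.
      points-somewhere : ∀ t → ∃[ s ] (tree ⊢ t ~ s × points t s ≡ true)
      points-somewhere t = map₂ (λ (s∈ , eq) → ∈-neighbours⁻ s∈ , eq) (⨁-true⇒∃ (neighbours t)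
          (trans (parity-⨁ (neighbours t) (λ s → half s t) inX (freeRow t) (freeCol t) all-branches)
                 (parity-X (freeRow t) (freeCol t))))
        where
        all-branches : ∀ {x} → x ∈ V (row (freeRow t)) → ⨁ (neighbours t) (λ s → half s t x) ≡ inX x
        all-branches {x} x∈row = trans
            (⨁-∧ˡ (neighbours t) (inX x) (λ s → side s t (node x))) (by-case (x ∈? X))
          where
          by-case : Dec (x ∈ X) → inX x ∧ branches t (node x) ≡ inX x
          by-case (no x∉) rewrite dec-false (x ∈? X) x∉ = refl
          -- If the node of `x` were `t`, then `x` would lie in `bag t`, which the row avoids.
          by-case (yes x∈) = trans (cong (inX x ∧_) (branches-other λ eq →
            freeRow-avoids t (x , x∈p∩q⁺ (x∈row , subst (λ r → x ∈ bag r) eq (∈-bag-node x∈)))))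
            (∧-identityʳ (inX x))

      -- Measured at one crossing, the parities of the two halves add up to that of `X`.
      points-one-way : ∀ {s t} → tree ⊢ s ~ t → points t s xor points s t ≡ true
      points-one-way {s} {t} s~t = begin
          points t s xor points s t
            ≡⟨ cong (points t s xor_) same ⟨
          points t s xor parity (half t s) (freeRow t) (freeCol t)
            ≡⟨ cong (points t s xor_) (xor-identityʳ _) ⟨
          ⨁ (half s t ∷ half t s ∷ []) (λ Y → parity Y (freeRow t) (freeCol t))
            ≡⟨ parity-⨁ (half s t ∷ half t s ∷ []) id inX (freeRow t) (freeCol t) (λ {x} _ → sum x) ⟩
          parity inX (freeRow t) (freeCol t)
            ≡⟨ parity-X (freeRow t) (freeCol t) ⟩
          true ∎
        where
        open ≡-Reasoning
        weaken : ∀ H {β β′} → β ⊆ β′ → Avoids H β′ → Avoids H β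
        weaken H {β} β⊆β′ avoids (x , x∈) = let x∈H , x∈β = x∈p∩q⁻ (V H) β x∈ in
          avoids (x , x∈p∩q⁺ (x∈H , β⊆β′ x∈β))
        -- The row chosen for `t` and the column chosen for `s` both avoid the intersection of the
        -- two bags, so they link the two crossings.
        same : parity (half t s) (freeRow t) (freeCol t) ≡ points s t
        same = parity-unique (half t s) (half⊆X t s) (bag t ∩ bag s) (half-closed t s)
          (weaken (row (freeRow t)) (p∩q⊆p (bag t) (bag s)) (freeRow-avoids t))
          (weaken (col (freeCol s)) (p∩q⊆q (bag t) (bag s)) (freeCol-avoids s))
        sum : ∀ x → half s t x xor (half t s x xor false) ≡ inX x
        sum x = trans (cong (half s t x xor_) (xor-identityʳ _))
          (trans (sym (∧-distribˡ-xor (inX x) (side s t (node x)) (side t s (node x))))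
            (trans (cong (inX x ∧_) (sides-complementary s~t spanning (node x))) (∧-identityʳ (inX x))))

      -- The oriented edges that point away from `t`: their tail is on the side of `t`.
      Ahead : Fin M → Fin M × Fin M → Set
      Ahead t (a , b) = points a b ≡ true × side a b t ≡ true

      ahead? : ∀ t → Decidable (Ahead t)
      ahead? t (a , b) = (points a b Bool.≟ true) ×-dec (side a b t Bool.≟ true)

      potential : Fin M → ℕ
      potential t = length (filter (ahead? t) (darts tree))

      -- The step leaves its own edge behind. No edge newly lies ahead, since sides change only at
      -- this edge and `points-one-way` excludes its reversal.
      potential-decreases : ∀ {s t} → tree ⊢ t ~ s → points t s ≡ true → potential s < potential t
      potential-decreases {s} {t} t~s pts = length-filter-< (ahead? s) (ahead? t) (darts tree)
          (λ d∈ (p , q) → p , still-ahead (∈-darts⁻ tree d∈) p q) (∈-darts⁺ tree t~s)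
          (λ (_ , q) → contra (trans (sym q) (side-opposite t~s)))
          (pts , side-self t s)
        where
        contra : true ≢ false
        contra ()
        not-back : points s t ≢ true
        not-back pst = contra (trans (sym (points-one-way (symmetric tree t~s)))
                                     (cong₂ _xor_ pts pst))
        still-ahead : ∀ {a b} → tree ⊢ a ~ b → points a b ≡ true → side a b s ≡ true → side a b t ≡ true
        still-ahead {a} {b} a~b p q with sameEdge? a b t s
        ... | yes (inj₁ (refl , refl)) = side-self t s
        ... | yes (inj₂ (refl , refl)) = ⊥-elim (not-back p)
        ... | no other = trans (side-other-edge t~s other) q

      -- Infinite descent: every node has an outgoing edge, and following it lowers the potential.
      no-node : ∀ k t → potential t ≢ k
      no-node = <-rec (λ k → ∀ t → potential t ≢ k) λ where
        _ smaller t refl → let s , t~s , pts = points-somewhere t in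
          smaller (potential-decreases t~s pts) s refl

    maxBag-bound : n ≤ maxBag D
    maxBag-bound = ℕ.≮⇒≥ λ small → no-node small _ (proj₁ (IsTree.nonempty isTree)) refl

-- The bound on the tree-width

theorem4 : ∀ {N} (n Δ : ℕ) → 1 ≤ n → 3 ≤ Δ →
    (G S₁ S₂ : Graph N) (slab : Slab n G S₁ S₂) → SlabDegree≤ Δ slab →
    (X : Subset N) → X ⊆ V G ─ (V S₁ ∪ V S₂) →
    Separates G S₁ S₂ X →
    (tw : ℤ) → IsTreeWidth (induced G X) tw → tw ≥ n /√ (3 * Δ) −1
theorem4 n Δ 1≤n 3≤Δ G S₁ S₂ slab _ X X⊆ separates _ ((D , refl) , _) =
  subst (λ w → 0ℤ ℤ.≤ w × + (n * n) ℤ.≤ + (3 * Δ) ℤ.* (w ℤ.* w)) (sym width+1)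
    (ℤ.+≤+ z≤n , subst (+ (n * n) ℤ.≤_) products (ℤ.+≤+ n²≤))
  where
  m : ℕ
  m = maxBag D
  n≤m : n ≤ m
  n≤m = maxBag-bound 1≤n slab X X⊆ separates D
  width+1 : width D ℤ.+ 1ℤ ≡ + m
  width+1 = trans (cong (ℤ._+ 1ℤ) (sym (ℤ.m-n≡m⊖n m 1)))
              (trans (ℤ.+-assoc (+ m) (ℤ.- 1ℤ) 1ℤ) (ℤ.+-identityʳ (+ m)))
  products : + (3 * Δ * (m * m)) ≡ + (3 * Δ) ℤ.* (+ m ℤ.* + m)
  products = trans (ℤ.pos-* (3 * Δ) (m * m)) (cong (+ (3 * Δ) ℤ.*_) (ℤ.pos-* m m))
  -- Squaring `n ≤ m` suffices, as the factor `3 * Δ` is at least 1.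
  n²≤ : n * n ≤ 3 * Δ * (m * m)
  n²≤ = ℕ.≤-trans (ℕ.*-mono-≤ n≤m n≤m) (subst (_≤ 3 * Δ * (m * m)) (ℕ.*-identityˡ (m * m))
    (ℕ.*-monoˡ-≤ (m * m) (ℕ.*-mono-≤ {1} {3} {1} (s≤s z≤n) (ℕ.≤-trans (s≤s z≤n) 3≤Δ))))
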